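{- Let $q$ be a prime power, $n\geq 3$ and $1\leq k<\frac{n}{2}$ integers, and assume that $q\geq 17$ if $k=1$ and $q\geq 13$ if $k\geq 2$. Let $\mathcal{H}(n,n-k,q)$ be the hypergraph whose vertices are the points of $\mathrm{PG}(n,q)$ and whose hyperedges are the $(n-k)$-dimensional subspaces of $\mathrm{PG}(n,q)$. Then \[\bar\chi(\mathcal{H}(n,n-k,q))=\theta_n-\tau_2(\mathcal{H}(n,n-k,q))+1=\theta_n-2\theta_k+1.\]
   Context: For a hypergraph $\mathcal{H}=(V;E)$, a strict $N$-coloring is a partition of $V$ into exactly $N$ nonempty color classes. A hyperedge is rainbow if no two of its vertices have the same color. The upper chromatic number $\bar\chi(\mathcal{H})$ is the largest $N$ such that $\mathcal{H}$ admits a strict $N$-coloring with no rainbow hyperedge. A $t$-transversal is a vertex set $T$ with $|T\cap H|\geq t$ for every hyperedge $H$, and $\tau_t(\mathcal{H})$ is the minimum size of a $t$-transversal. Dimensions are projective, and $\theta_m=\frac{q^{m+1}-1}{q-1}=q^m+\dots+q+1$ is the number of points of an $m$-dimensional projective space of order $q$. -}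

module Defs where

open import Level using (0ℓ)
open import Data.Nat as ℕ using (ℕ; zero; suc; _^_; _≤_)
open import Data.Nat.Primality using (Prime)
open import Data.Fin as Fin using (Fin; suc)
open import Data.List using (List; length)
open import Data.List.Membership.Propositional using (_∈_)
open import Data.List.Relation.Unary.All using (All)
open import Data.List.Relation.Unary.Any using (Any)
open import Data.List.Relation.Unary.AllPairs using (AllPairs)
open import Data.Product using (Σ; ∃; _×_)
open import Relation.Nullary using (¬_)
open import Relation.Binary.Definitions using (Decidable)
open import Relation.Binary.PropositionalEquality using (_≡_)
open import Algebra.Bundles using (CommutativeRing)

IsPrimePower : ℕ → Set
IsPrimePower q = Σ ℕ λ p → Σ ℕ λ e → Prime p × q ≡ p ^ suc e

-- θ q m = q^m + ... + q + 1  (number of points of PG(m,q))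
θ : ℕ → ℕ → ℕ
θ q zero    = 1
θ q (suc m) = q ^ suc m ℕ.+ θ q m

record Hypergraph : Set₁ where
  field
    V    : Set
    _≈V_ : V → V → Set
    E    : Set
    _∈E_ : V → E → Set

module _ (ℋ : Hypergraph) where
  open Hypergraph ℋ

  Distinct : List V → Set
  Distinct = AllPairs (λ v w → ¬ (v ≈V w))

  record StrictColouring (N : ℕ) : Set where
    field
      colour     : V → Fin N
      respects   : ∀ {v w} → v ≈V w → colour v ≡ colour w
      surjective : ∀ (j : Fin N) → ∃ λ v → colour v ≡ j

  Rainbow : ∀ {N} → StrictColouring N → E → Set
  Rainbow c H = ∀ v w → v ∈E H → w ∈E H → StrictColouring.colour c v ≡ StrictColouring.colour c w → v ≈V w

  HasNonRainbowColouring : ℕ → Set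
  HasNonRainbowColouring N = Σ (StrictColouring N) λ c → ∀ H → ¬ Rainbow c H

  UpperChromaticNumberIs : ℕ → Set
  UpperChromaticNumberIs N =
    HasNonRainbowColouring N × (∀ M → HasNonRainbowColouring M → M ≤ N)

  IsTransversal : ℕ → List V → Set
  IsTransversal t T = Distinct T × (∀ H → Σ (List V) λ S →
    t ≤ length S × Distinct S × All (_∈ T) S × All (_∈E H) S)

  TauIs : ℕ → ℕ → Set
  TauIs t τ = (Σ (List V) λ T → IsTransversal t T × length T ≡ τ)
            × (∀ T → IsTransversal t T → τ ≤ length T)

record FiniteField (q : ℕ) : Set₁ where
  field
    ring : CommutativeRing 0ℓ 0ℓ
  open CommutativeRing ring public hiding (ring)
  field
    _≟_           : Decidable _≈_
    0≉1           : ¬ (0# ≈ 1#)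
    inverse       : ∀ x → ¬ (x ≈ 0#) → ∃ λ y → x * y ≈ 1#
    elements      : List Carrier
    enum-length   : length elements ≡ q
    enum-complete : ∀ x → Any (x ≈_) elements
    enum-distinct : AllPairs (λ x y → ¬ (x ≈ y)) elements

module Projective {q : ℕ} (𝔽 : FiniteField q) (n : ℕ) where
  open FiniteField 𝔽 using (Carrier; _≈_; _+_; _*_; 0#)

  Vect : Set
  Vect = Fin (suc n) → Carrier

  0v : Vect
  0v i = 0#

  lincomb : ∀ {d} → (Fin d → Carrier) → (Fin d → Vect) → Vect
  lincomb {ℕ.zero}  a b i = 0#
  lincomb {suc d} a b i = a Fin.zero * b Fin.zero i + lincomb (λ j → a (suc j)) (λ j → b (suc j)) i

  record Point : Set where
    field
      vec     : Vect
      nonzero : ¬ (∀ i → vec i ≈ 0#)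

  _≈P_ : Point → Point → Set
  x ≈P y = ∃ λ λ₀ → ∀ i → Point.vec y i ≈ λ₀ * Point.vec x i

  -- projective m-dimensional subspace = span of m+1 linearly independent vectors
  record Subspace (m : ℕ) : Set where
    field
      basis       : Fin (suc m) → Vect
      independent : ∀ (a : Fin (suc m) → Carrier) →
                    (∀ i → lincomb a basis i ≈ 0#) → ∀ j → a j ≈ 0#

  _∈S_ : ∀ {m} → Point → Subspace m → Set
  x ∈S U = ∃ λ (a : Fin _ → Carrier) → ∀ i → Point.vec x i ≈ lincomb a (Subspace.basis U) i

  ℋ : ℕ → Hypergraph
  ℋ m = record { V = Point ; _≈V_ = _≈P_ ; E = Subspace m ; _∈E_ = _∈S_ }

{-# OPTIONS --safe #-}
-- Let K = q^k. For a (k+1) × (n+1) matrix A and a point ⟨u⟩ of PG(k,q), the preimage A⁻¹⟨u⟩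
-- contains an (n-k)-dimensional subspace, so it carries two points of the same colour. For a
-- uniformly random A and fixed u, the events x ∈ A⁻¹⟨u⟩ are pairwise independent of probability
-- 1/K, so the first two moments of the number of points of each colour in A⁻¹⟨u⟩ are known.
-- Suppose that there are more than θ_n - 2θ_k + 1 colours, with class sizes c₁ ≥ c₂ ≥ …;
-- then c₁ + c₂ + Σ_{j≥3} (c_j - 1) ≤ 2θ_k. If ker A misses the largest class, its points are
-- distributed over the θ_k members A⁻¹⟨u⟩ of the pencil of A, and at least (2θ_k - c₁)/2 of
-- these must repeat another colour; averaging over A gives c₂ ≥ 4K/5. For fixed u, averaging
-- an inequality in a₁, a₂ and the pairs of the other colours that holds as soon as some colour
-- is repeated then gives 10K² + 2c₁c₂ ≤ 4K(c₁ + c₂) + c₁² + c₂² + 5c₂ Σ_{j≥3} (c_j - 1),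
-- which is impossible since 12θ_k ≤ 13K.
-- Conversely, a 2-transversal T yields a colouring without rainbow hyperedges: T becomes one
-- class and all other points are singletons. Hence the bound on the number of colours also
-- bounds τ₂ from below, and two disjoint k-dimensional subspaces attain both bounds.
module Submission where

open import Defs
open import Data.Nat using (ℕ; zero; suc; _+_; _*_; _∸_; _^_; _≤_; _<_; NonZero; >-nonZero; z≤n; s≤s; s≤s⁻¹)
open import Data.Nat.Properties
open import Data.Nat.Tactic.RingSolver using (solve-∀)
open import Data.Fin as Fin using (Fin; zero; suc; punchIn; punchOut)
import Data.Fin.Properties as Fin
open import Data.Vec.Functional as Vector using (head; tail)
open import Data.List using (List; []; _∷_; _++_; map; length; lookup; allFin; filter; cartesianProductWith)
import Data.List.Properties as List
import Data.List.Membership.Propositional.Properties as ∈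
import Data.List.Relation.Unary.Unique.Propositional.Properties as Unique
open import Data.List.Membership.Propositional using (_∈_)
open import Data.List.Relation.Unary.All as All using (All; []; _∷_)
open import Data.List.Relation.Unary.Any as Any using (Any; here; there)
open import Data.List.Relation.Unary.AllPairs as AllPairs using (AllPairs; []; _∷_)
open import Data.Product using (Σ; ∃; _×_; _,_; proj₁; proj₂)
open import Data.Empty using (⊥)
open import Data.Sum using (_⊎_; inj₁; inj₂; [_,_]′; swap)
open import Data.Sum.Properties using (swap-involutive)
open import Function using (_∘_; id; const)
open import Relation.Nullary using (¬_; Dec; yes; no; ¬?; contradiction; _×-dec_)
open import Relation.Nullary.Decidable using (map′; decidable-stable)
import Relation.Unary as Unary
open import Relation.Binary.PropositionalEquality using (_≡_; _≢_; refl; sym; trans; cong; cong₂; subst; subst₂)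
open import Data.Unit using (⊤; tt)
import Data.Vec.Functional.Properties as Vector
import Algebra.Solver.Ring.NaturalCoefficients.Default
import Algebra.Properties.AbelianGroup
import Relation.Binary.Reasoning.Setoid as ≈-Reasoning
import Data.Vec.Functional.Relation.Binary.Equality.Setoid
import Data.List.Relation.Unary.Unique.Setoid.Properties as Setoid-Unique
import Data.List.Membership.Setoid.Properties as Setoid-∈
import Data.List.Relation.Unary.Any.Properties as AnyP
import Data.List.Relation.Unary.All.Properties as AllP
import Data.List.Relation.Unary.AllPairs.Properties as AllPairsP

-- Finite sums, products, tuples and indicator functions.

private variable
  A B C P Q : Set

∑ : List A → (A → ℕ) → ℕ
∑ []       f = 0
∑ (x ∷ xs) f = f x + ∑ xs f

infix 5 ∑
syntax ∑ xs (λ x → e) = ∑[ x ← xs ] e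

∏ : ∀ {n} → (Fin n → ℕ) → ℕ
∏ {zero}  f = 1
∏ {suc n} f = f zero * ∏ (tail f)

tuples : List A → (n : ℕ) → List (Fin n → A)
tuples xs zero    = Vector.[] ∷ []
tuples xs (suc n) = cartesianProductWith Vector._∷_ xs (tuples xs n)

𝟙 : Dec P → ℕ
𝟙 (yes _) = 1
𝟙 (no _)  = 0

𝟙-idem : (d : Dec P) → 𝟙 d * 𝟙 d ≡ 𝟙 d
𝟙-idem (yes _) = refl
𝟙-idem (no _)  = refl

𝟙-true : (d : Dec P) → P → 𝟙 d ≡ 1
𝟙-true (yes _) _ = refl
𝟙-true (no ¬p) p = contradiction p ¬p

𝟙-false : (d : Dec P) → ¬ P → 𝟙 d ≡ 0
𝟙-false (yes p) ¬p = contradiction p ¬p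
𝟙-false (no _)  _  = refl

𝟙-cong : (d : Dec P) (e : Dec Q) → (P → Q) → (Q → P) → 𝟙 d ≡ 𝟙 e
𝟙-cong (yes p) e f g = sym (𝟙-true e (f p))
𝟙-cong (no ¬p) e f g = sym (𝟙-false e (¬p ∘ g))

𝟙-× : (d : Dec P) (e : Dec Q) → 𝟙 d * 𝟙 e ≡ 𝟙 (d ×-dec e)
𝟙-× (yes _) (yes _) = refl
𝟙-× (yes _) (no _)  = refl
𝟙-× (no _)  _       = refl

𝟙-¬ : (d : Dec P) → 𝟙 d + 𝟙 (¬? d) ≡ 1
𝟙-¬ (yes _) = refl
𝟙-¬ (no _)  = refl

∑-cong : ∀ (xs : List A) {f g} → (∀ x → f x ≡ g x) → ∑ xs f ≡ ∑ xs g
∑-cong []       e = refl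
∑-cong (x ∷ xs) e = cong₂ _+_ (e x) (∑-cong xs e)

∑-mono : ∀ (xs : List A) {f g} → (∀ x → f x ≤ g x) → ∑ xs f ≤ ∑ xs g
∑-mono []       e = z≤n
∑-mono (x ∷ xs) e = +-mono-≤ (e x) (∑-mono xs e)

∑-const : ∀ (xs : List A) c → ∑ xs (const c) ≡ length xs * c
∑-const []       c = refl
∑-const (x ∷ xs) c = cong (c +_) (∑-const xs c)

∑-zero : ∀ (xs : List A) → ∑ xs (const 0) ≡ 0
∑-zero xs = trans (∑-const xs 0) (*-zeroʳ (length xs))

∑-+ : ∀ (xs : List A) f g → ∑[ x ← xs ] (f x + g x) ≡ ∑ xs f + ∑ xs g
∑-+ []       f g = refl
∑-+ (x ∷ xs) f g = trans (cong (f x + g x +_) (∑-+ xs f g)) (interchange (f x) (g x) _ _)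
  where
  interchange : ∀ a b c d → a + b + (c + d) ≡ a + c + (b + d)
  interchange = solve-∀

∑-*ˡ : ∀ c (xs : List A) f → c * ∑ xs f ≡ ∑[ x ← xs ] (c * f x)
∑-*ˡ c []       f = *-zeroʳ c
∑-*ˡ c (x ∷ xs) f = trans (*-distribˡ-+ c (f x) _) (cong (c * f x +_) (∑-*ˡ c xs f))

∑-*ʳ : ∀ c (xs : List A) f → ∑ xs f * c ≡ ∑[ x ← xs ] (f x * c)
∑-*ʳ c xs f = trans (*-comm _ c) (trans (∑-*ˡ c xs f) (∑-cong xs λ x → *-comm c (f x)))

∑-comm : ∀ (xs : List A) (ys : List B) (f : A → B → ℕ) →
         ∑[ x ← xs ] ∑[ y ← ys ] f x y ≡ ∑[ y ← ys ] ∑[ x ← xs ] f x y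
∑-comm []       ys f = sym (∑-zero ys)
∑-comm (x ∷ xs) ys f = trans (cong (∑ ys (f x) +_) (∑-comm xs ys f)) (sym (∑-+ ys (f x) _))

∑-*-∑ : ∀ (xs : List A) (ys : List B) f g →
        ∑ xs f * ∑ ys g ≡ ∑[ x ← xs ] ∑[ y ← ys ] (f x * g y)
∑-*-∑ xs ys f g = trans (∑-*ʳ _ xs f) (∑-cong xs λ x → ∑-*ˡ (f x) ys g)

∑-++ : ∀ (xs ys : List A) f → ∑ (xs ++ ys) f ≡ ∑ xs f + ∑ ys f
∑-++ []       ys f = refl
∑-++ (x ∷ xs) ys f = trans (cong (f x +_) (∑-++ xs ys f)) (sym (+-assoc (f x) _ _))

∑-map : ∀ (h : A → B) xs f → ∑ (map h xs) f ≡ ∑[ x ← xs ] f (h x)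
∑-map h []       f = refl
∑-map h (x ∷ xs) f = cong (f (h x) +_) (∑-map h xs f)

∑-cartesianProductWith : ∀ (h : A → B → C) xs ys f →
  ∑ (cartesianProductWith h xs ys) f ≡ ∑[ x ← xs ] ∑[ y ← ys ] f (h x y)
∑-cartesianProductWith h []       ys f = refl
∑-cartesianProductWith h (x ∷ xs) ys f =
  trans (∑-++ (map (h x) ys) _ f) (cong₂ _+_ (∑-map (h x) ys f) (∑-cartesianProductWith h xs ys f))

length-∑ : ∀ (xs : List A) → ∑ xs (const 1) ≡ length xs
length-∑ xs = trans (∑-const xs 1) (*-identityʳ _)

length-cartesianProductWith : ∀ (h : A → B → C) xs ys →
  length (cartesianProductWith h xs ys) ≡ length xs * length ys
length-cartesianProductWith h xs ys =
  trans (sym (length-∑ (cartesianProductWith h xs ys)))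
  (trans (∑-cartesianProductWith h xs ys (const 1))
  (trans (∑-cong xs λ _ → length-∑ ys) (∑-const xs (length ys))))

length-tuples : ∀ (xs : List A) n → length (tuples xs n) ≡ length xs ^ n
length-tuples xs zero    = refl
length-tuples xs (suc n) =
  trans (length-cartesianProductWith Vector._∷_ xs (tuples xs n)) (cong (length xs *_) (length-tuples xs n))

-- Distributivity. Applied to matrices as tuples of rows, it expresses that the rows of a uniformly
-- random matrix are independent.
∑-tuples-∏ : ∀ (xs : List A) n (f : Fin n → A → ℕ) →
  ∑[ v ← tuples xs n ] ∏ (λ i → f i (v i)) ≡ ∏ (λ i → ∑ xs (f i))
∑-tuples-∏ xs zero    f = refl
∑-tuples-∏ xs (suc n) f =
  trans (∑-cartesianProductWith Vector._∷_ xs (tuples xs n) _)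
  (trans (sym (∑-*-∑ xs (tuples xs n) (f zero) _))
  (cong (∑ xs (f zero) *_) (∑-tuples-∏ xs n (f ∘ suc))))

∏-cong : ∀ {n} {f g : Fin n → ℕ} → (∀ i → f i ≡ g i) → ∏ f ≡ ∏ g
∏-cong {zero}  e = refl
∏-cong {suc n} e = cong₂ _*_ (e zero) (∏-cong (e ∘ suc))

∏-const : ∀ n c → ∏ {n} (const c) ≡ c ^ n
∏-const zero    c = refl
∏-const (suc n) c = cong (c *_) (∏-const n c)

∏-* : ∀ {n} (f g : Fin n → ℕ) → ∏ (λ i → f i * g i) ≡ ∏ f * ∏ g
∏-* {zero}  f g = refl
∏-* {suc n} f g = trans (cong (f zero * g zero *_) (∏-* (tail f) (tail g))) (interchange (f zero) (g zero) _ _)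
  where
  interchange : ∀ a b c d → a * b * (c * d) ≡ a * c * (b * d)
  interchange = solve-∀

𝟙-all : ∀ {n} {P : Fin n → Set} (d : ∀ i → Dec (P i)) (e : Dec (∀ i → P i)) → 𝟙 e ≡ ∏ (λ i → 𝟙 (d i))
𝟙-all {zero}  d e = 𝟙-true e λ ()
𝟙-all {suc n} d e = trans
  (𝟙-cong e (d zero ×-dec Fin.all? (d ∘ suc)) (λ h → h zero , h ∘ suc) λ { (h , _) zero → h ; (_ , h) (suc i) → h i })
  (trans (sym (𝟙-× (d zero) _)) (cong (𝟙 (d zero) *_) (𝟙-all (d ∘ suc) _)))

f≤∑ : ∀ {xs : List A} f {x} → x ∈ xs → f x ≤ ∑ xs f
f≤∑ {xs = _ ∷ xs} f (here refl) = m≤m+n _ _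
f≤∑ {xs = y ∷ xs} f (there x∈)  = ≤-trans (f≤∑ f x∈) (m≤n+m _ (f y))

∑𝟙-none : ∀ {P : A → Set} (P? : Unary.Decidable P) {xs} → All (λ x → ¬ P x) xs → ∑[ x ← xs ] 𝟙 (P? x) ≡ 0
∑𝟙-none P? []         = refl
∑𝟙-none P? (¬p ∷ ¬ps) = cong₂ _+_ (𝟙-false (P? _) ¬p) (∑𝟙-none P? ¬ps)

∑𝟙-≤1 : ∀ {P : A → Set} (P? : Unary.Decidable P) {xs} →
  AllPairs (λ x y → P x → ¬ P y) xs → ∑[ x ← xs ] 𝟙 (P? x) ≤ 1
∑𝟙-≤1 P? []                         = z≤n
∑𝟙-≤1 P? {x ∷ xs} (x# ∷ xs#) with P? x
... | yes p = ≤-reflexive (cong suc (∑𝟙-none P? (All.map (λ n → n p) x#)))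
... | no ¬p = ∑𝟙-≤1 P? xs#

∑𝟙-≥1 : ∀ {P : A → Set} (P? : Unary.Decidable P) {xs} → Any P xs → 1 ≤ ∑[ x ← xs ] 𝟙 (P? x)
∑𝟙-≥1 P? {x ∷ xs} (here p)   = ≤-trans (≤-reflexive (sym (𝟙-true (P? x) p))) (m≤m+n _ _)
∑𝟙-≥1 P? {x ∷ xs} (there ps) = ≤-trans (∑𝟙-≥1 P? ps) (m≤n+m _ (𝟙 (P? x)))

∑𝟙-unique : ∀ {P : A → Set} (P? : Unary.Decidable P) {xs} →
  AllPairs (λ x y → P x → ¬ P y) xs → Any P xs → ∑[ x ← xs ] 𝟙 (P? x) ≡ 1
∑𝟙-unique P? xs# any = ≤-antisym (∑𝟙-≤1 P? xs#) (∑𝟙-≥1 P? any)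

∈-allFin : ∀ {n} (i : Fin n) → i ∈ allFin n
∈-allFin = ∈.∈-allFin

∑-allFin-1 : ∀ n → ∑ (allFin n) (const 1) ≡ n
∑-allFin-1 n = trans (length-∑ (allFin n)) (List.length-tabulate id)

∑-δ : ∀ {n} (y : Fin n) (f : Fin n → ℕ) → ∑[ x ← allFin n ] (𝟙 (x Fin.≟ y) * f x) ≡ f y
∑-δ {n} y f = trans (∑-cong (allFin n) pointwise)
  (trans (sym (∑-*ʳ (f y) (allFin n) _))
  (trans (cong (_* f y) (∑𝟙-unique (Fin._≟ y) (AllPairs.map distinct (Unique.allFin⁺ n)) (Any.map sym (∈-allFin y))))
  (*-identityˡ (f y))))
  where
  distinct : ∀ {a b} → a ≢ b → a ≡ y → b ≢ y
  distinct a≢b refl refl = a≢b refl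
  pointwise : ∀ x → 𝟙 (x Fin.≟ y) * f x ≡ 𝟙 (x Fin.≟ y) * f y
  pointwise x with x Fin.≟ y
  ... | yes refl = refl
  ... | no _     = refl

∑-allFin-suc : ∀ {n} (f : Fin (suc n) → ℕ) → ∑ (allFin (suc n)) f ≡ f zero + ∑ (allFin n) (f ∘ suc)
∑-allFin-suc {n} f =
  cong (f zero +_) (trans (cong (λ xs → ∑ xs f) (sym (List.map-tabulate id suc))) (∑-map suc (allFin n) f))

-- Splits off one index; applied twice, it separates the two largest colour classes from the rest.
∑-punchIn : ∀ {n} (i : Fin (suc n)) (f : Fin (suc n) → ℕ) →
  ∑ (allFin (suc n)) f ≡ f i + ∑ (allFin n) (f ∘ punchIn i)
∑-punchIn         zero    f = ∑-allFin-suc f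
∑-punchIn {suc n} (suc i) f = trans (∑-allFin-suc f)
  (trans (cong (f zero +_) (∑-punchIn i (f ∘ suc)))
  (trans (exchange (f zero) (f (suc i)) _) (cong (f (suc i) +_) (sym (∑-allFin-suc (f ∘ punchIn (suc i)))))))
  where
  exchange : ∀ a b c → a + (b + c) ≡ b + (a + c)
  exchange = solve-∀

f+f≤∑ : ∀ {n} (f : Fin n → ℕ) {x y} → x ≢ y → f x + f y ≤ ∑ (allFin n) f
f+f≤∑ {zero}  f {()}
f+f≤∑ {suc n} f {x} {y} x≢y = subst (f x + f y ≤_) (sym (∑-punchIn x f))
  (+-monoʳ-≤ (f x) (subst (λ z → f z ≤ ∑ (allFin n) (f ∘ punchIn x)) (Fin.punchIn-punchOut x≢y) (f≤∑ (f ∘ punchIn x) (∈-allFin (punchOut x≢y)))))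

argmax : ∀ {n} (f : Fin (suc n) → ℕ) → ∃ λ i → ∀ j → f j ≤ f i
argmax {zero}  f = zero , λ { zero → ≤-refl }
argmax {suc n} f with argmax (f ∘ suc)
... | i , i-max with ≤-total (f zero) (f (suc i))
...   | inj₁ f0≤ = suc i , λ { zero → f0≤ ; (suc j) → i-max j }
...   | inj₂ ≤f0 = zero , λ { zero → ≤-refl ; (suc j) → ≤-trans (i-max j) ≤f0 }

-- Numerical inequalities behind the two averaging arguments.

am-gm : ∀ x y → 2 * (x * y) ≤ x * x + y * y
am-gm x y with ≤-total x y
... | inj₁ x≤y = subst (λ z → 2 * (x * z) ≤ x * x + z * z) (m+[n∸m]≡n x≤y) (ordered x (y ∸ x))
  where
  ordered : ∀ x d → 2 * (x * (x + d)) ≤ x * x + (x + d) * (x + d)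
  ordered x d = subst (2 * (x * (x + d)) ≤_) (e x d) (m≤m+n _ (d * d))
    where
    e : ∀ x d → 2 * (x * (x + d)) + d * d ≡ x * x + (x + d) * (x + d)
    e = solve-∀
... | inj₂ y≤x = subst (λ z → 2 * (z * y) ≤ z * z + y * y) (m+[n∸m]≡n y≤x) (ordered y (x ∸ y))
  where
  ordered : ∀ y d → 2 * ((y + d) * y) ≤ (y + d) * (y + d) + y * y
  ordered y d = subst (2 * ((y + d) * y) ≤_) (e y d) (m≤m+n _ (d * d))
    where
    e : ∀ y d → 2 * ((y + d) * y) + d * d ≡ (y + d) * (y + d) + y * y
    e = solve-∀

-- In the application K = q^k, t = θ_k, and c₁, c₂ (below: x, y) are the two largest class sizes.
second-class-large : ∀ q K t c₁ c₂ → 13 ≤ q → 0 < K → 12 * t ≤ 13 * K → c₁ + c₂ ≤ 2 * t →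
  q * (K * K) ≤ c₁ * K + t * q * c₂ → 4 * K ≤ 5 * c₂
second-class-large q K t c₁ c₂ 13≤q 0<K t≤K c≤t main with 5 * c₂ <? 4 * K
... | no ≮ = ≮⇒≥ ≮
... | yes c₂<K = contradiction absurd (<⇒≱ short)
  where
  open ≤-Reasoning
  instance
    K≢0 : NonZero K
    K≢0 = >-nonZero 0<K
  -- Adding 60c₂K to 60 times `main` creates the term 60(c₁ + c₂)K. The bounds on c₁ + c₂ and on t
  -- then eliminate c₁ and t, and a factor K can be cancelled.
  scaled : (60 * (q * K) + 60 * c₂) * K ≤ (130 * K + 13 * q * (5 * c₂)) * K
  scaled = begin
    (60 * (q * K) + 60 * c₂) * K ≡⟨ e₁ q K c₂ ⟩
    60 * (q * (K * K)) + 60 * (c₂ * K) ≤⟨ +-monoˡ-≤ (60 * (c₂ * K)) (*-monoʳ-≤ 60 main) ⟩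
    60 * (c₁ * K + t * q * c₂) + 60 * (c₂ * K) ≡⟨ e₂ q K t c₁ c₂ ⟩
    60 * ((c₁ + c₂) * K) + 5 * ((12 * t) * (q * c₂))
      ≤⟨ +-mono-≤ (*-monoʳ-≤ 60 (*-monoˡ-≤ K c≤t)) (*-monoʳ-≤ 5 (*-monoˡ-≤ (q * c₂) t≤K)) ⟩
    60 * ((2 * t) * K) + 5 * ((13 * K) * (q * c₂)) ≡⟨ e₃ q K t c₂ ⟩
    10 * ((12 * t) * K) + 5 * ((13 * K) * (q * c₂))
      ≤⟨ +-monoˡ-≤ (5 * ((13 * K) * (q * c₂))) (*-monoʳ-≤ 10 (*-monoˡ-≤ K t≤K)) ⟩
    10 * ((13 * K) * K) + 5 * ((13 * K) * (q * c₂)) ≡⟨ e₄ q K c₂ ⟩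
    (130 * K + 13 * q * (5 * c₂)) * K ∎
    where
    e₁ : ∀ q K c₂ → (60 * (q * K) + 60 * c₂) * K ≡ 60 * (q * (K * K)) + 60 * (c₂ * K)
    e₁ = solve-∀
    e₂ : ∀ q K t c₁ c₂ → 60 * (c₁ * K + t * q * c₂) + 60 * (c₂ * K) ≡
                          60 * ((c₁ + c₂) * K) + 5 * ((12 * t) * (q * c₂))
    e₂ = solve-∀
    e₃ : ∀ q K t c₂ → 60 * ((2 * t) * K) + 5 * ((13 * K) * (q * c₂)) ≡
                       10 * ((12 * t) * K) + 5 * ((13 * K) * (q * c₂))
    e₃ = solve-∀
    e₄ : ∀ q K c₂ → 10 * ((13 * K) * K) + 5 * ((13 * K) * (q * c₂)) ≡ (130 * K + 13 * q * (5 * c₂)) * K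
    e₄ = solve-∀
  linear : 60 * (q * K) + 60 * c₂ ≤ 130 * K + 13 * q * (5 * c₂)
  linear = *-cancelʳ-≤ (60 * (q * K) + 60 * c₂) (130 * K + 13 * q * (5 * c₂)) K scaled
  r : ℕ
  r = q ∸ 13
  q≡ : q ≡ 13 + r
  q≡ = sym (m+[n∸m]≡n 13≤q)
  linear′ : 60 * ((13 + r) * K) + 60 * c₂ ≤ 130 * K + 13 * (13 + r) * (5 * c₂)
  linear′ = subst (λ z → 60 * (z * K) + 60 * c₂ ≤ 130 * K + 13 * z * (5 * c₂)) q≡ linear
  rest : ℕ
  rest = 758 * K + 52 * (r * K) + 60 * c₂
  -- With q = 13 + r the left side of `linear` is 780K + 60rK + 60c₂, while 5c₂ < 4K keeps the right
  -- side at most 758K + 52rK + 60c₂.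
  absurd : (22 * K + 8 * (r * K)) + rest ≤ rest
  absurd = begin
    (22 * K + 8 * (r * K)) + rest ≡⟨ e₁ K r c₂ ⟩
    60 * ((13 + r) * K) + 60 * c₂ ≤⟨ linear′ ⟩
    130 * K + 13 * (13 + r) * (5 * c₂) ≡⟨ e₂ K r c₂ ⟩
    130 * K + (157 + 13 * r) * (5 * c₂) + 60 * c₂
      ≤⟨ +-monoˡ-≤ (60 * c₂) (+-monoʳ-≤ (130 * K) (*-monoʳ-≤ (157 + 13 * r) (<⇒≤ c₂<K))) ⟩
    130 * K + (157 + 13 * r) * (4 * K) + 60 * c₂ ≡⟨ e₃ K r c₂ ⟩
    rest ∎
    where
    e₁ : ∀ K r c₂ → (22 * K + 8 * (r * K)) + (758 * K + 52 * (r * K) + 60 * c₂) ≡ 60 * ((13 + r) * K) + 60 * c₂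
    e₁ = solve-∀
    e₂ : ∀ K r c₂ → 130 * K + 13 * (13 + r) * (5 * c₂) ≡ 130 * K + (157 + 13 * r) * (5 * c₂) + 60 * c₂
    e₂ = solve-∀
    e₃ : ∀ K r c₂ → 130 * K + (157 + 13 * r) * (4 * K) + 60 * c₂ ≡ 758 * K + 52 * (r * K) + 60 * c₂
    e₃ = solve-∀
  short : rest < (22 * K + 8 * (r * K)) + rest
  short = +-monoˡ-≤ rest (≤-trans (≤-trans 0<K (m≤m+n K (21 * K))) (m≤m+n (22 * K) (8 * (r * K))))

-- The final contradiction. With x = y + d, the size constraint reads 12y + 6d + 6s ≤ 13K and keeps
-- d below both y and K; `main` then conflicts with (K - y)² ≥ 0, which enters through `am-gm`.
no-large-classes : ∀ K t x y s → 0 < K → 12 * t ≤ 13 * K → 4 * K ≤ 5 * y → y ≤ x → x + y + s ≤ 2 * t →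
  ¬ 10 * (K * K) + 2 * (x * y) ≤ 4 * (K * (x + y)) + (x * x + y * y) + 5 * (y * s)
no-large-classes K t x y s 0<K t≤K K≤y y≤x sum≤ main = contradiction absurd (<⇒≱ short)
  where
  open ≤-Reasoning
  d : ℕ
  d = x ∸ y
  x≡ : x ≡ y + d
  x≡ = sym (m+[n∸m]≡n y≤x)
  0<y : 0 < y
  0<y = *-cancelˡ-< 5 0 y (≤-trans (≤-trans 0<K (m≤m+n K (3 * K))) K≤y)
  budget : 12 * y + 6 * d + 6 * s ≤ 13 * K
  budget = begin
    12 * y + 6 * d + 6 * s ≡⟨ e y d s ⟩
    6 * (y + d + y + s) ≡⟨ cong (λ z → 6 * (z + y + s)) x≡ ⟨
    6 * (x + y + s) ≤⟨ *-monoʳ-≤ 6 sum≤ ⟩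
    6 * (2 * t) ≡⟨ *-assoc 6 2 t ⟨
    12 * t ≤⟨ t≤K ⟩
    13 * K ∎
    where
    e : ∀ y d s → 12 * y + 6 * d + 6 * s ≡ 6 * (y + d + y + s)
    e = solve-∀
  d≤y : d ≤ y
  d≤y = *-cancelˡ-≤ 24 (+-cancelˡ-≤ (48 * y) (24 * d) (24 * y) (begin
    48 * y + 24 * d ≤⟨ m≤m+n (48 * y + 24 * d) (24 * s) ⟩
    48 * y + 24 * d + 24 * s ≡⟨ e₁ y d s ⟩
    4 * (12 * y + 6 * d + 6 * s) ≤⟨ *-monoʳ-≤ 4 budget ⟩
    4 * (13 * K) ≡⟨ e₂ K ⟩
    13 * (4 * K) ≤⟨ *-monoʳ-≤ 13 K≤y ⟩
    13 * (5 * y) ≤⟨ m≤m+n (13 * (5 * y)) (7 * y) ⟩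
    13 * (5 * y) + 7 * y ≡⟨ e₃ y ⟩
    48 * y + 24 * y ∎))
    where
    e₁ : ∀ y d s → 48 * y + 24 * d + 24 * s ≡ 4 * (12 * y + 6 * d + 6 * s)
    e₁ = solve-∀
    e₂ : ∀ K → 4 * (13 * K) ≡ 13 * (4 * K)
    e₂ = solve-∀
    e₃ : ∀ y → 13 * (5 * y) + 7 * y ≡ 48 * y + 24 * y
    e₃ = solve-∀
  d≤K : d ≤ K
  d≤K = *-cancelˡ-≤ 30 (+-cancelˡ-≤ (12 * (4 * K)) (30 * d) (30 * K) (begin
    12 * (4 * K) + 30 * d ≤⟨ +-monoˡ-≤ (30 * d) (*-monoʳ-≤ 12 K≤y) ⟩
    12 * (5 * y) + 30 * d ≤⟨ m≤m+n (12 * (5 * y) + 30 * d) (30 * s) ⟩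
    12 * (5 * y) + 30 * d + 30 * s ≡⟨ e₁ y d s ⟩
    5 * (12 * y + 6 * d + 6 * s) ≤⟨ *-monoʳ-≤ 5 budget ⟩
    5 * (13 * K) ≤⟨ m≤m+n (5 * (13 * K)) (13 * K) ⟩
    5 * (13 * K) + 13 * K ≡⟨ e₂ K ⟩
    12 * (4 * K) + 30 * K ∎))
    where
    e₁ : ∀ y d s → 12 * (5 * y) + 30 * d + 30 * s ≡ 5 * (12 * y + 6 * d + 6 * s)
    e₁ = solve-∀
    e₂ : ∀ K → 5 * (13 * K) + 13 * K ≡ 12 * (4 * K) + 30 * K
    e₂ = solve-∀
  main′ : 10 * (K * K) ≤ 8 * (K * y) + 4 * (K * d) + d * d + 5 * (y * s)
  main′ = +-cancelʳ-≤ (2 * ((y + d) * y)) (10 * (K * K)) (8 * (K * y) + 4 * (K * d) + d * d + 5 * (y * s)) (begin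
    10 * (K * K) + 2 * ((y + d) * y) ≡⟨ cong (λ z → 10 * (K * K) + 2 * (z * y)) x≡ ⟨
    10 * (K * K) + 2 * (x * y) ≤⟨ main ⟩
    4 * (K * (x + y)) + (x * x + y * y) + 5 * (y * s)
      ≡⟨ cong (λ z → 4 * (K * (z + y)) + (z * z + y * y) + 5 * (y * s)) x≡ ⟩
    4 * (K * ((y + d) + y)) + ((y + d) * (y + d) + y * y) + 5 * (y * s) ≡⟨ e K y d s ⟩
    8 * (K * y) + 4 * (K * d) + d * d + 5 * (y * s) + 2 * ((y + d) * y) ∎)
    where
    e : ∀ K y d s → 4 * (K * ((y + d) + y)) + ((y + d) * (y + d) + y * y) + 5 * (y * s) ≡
                    8 * (K * y) + 4 * (K * d) + d * d + 5 * (y * s) + 2 * ((y + d) * y)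
    e = solve-∀
  -- Combines 120Ky ≤ 60(K² + y²), six times `main′` and 5y times `budget`. Here 4K ≤ 5y bounds 24Kd
  -- by 30yd, and d² ≤ Ky bounds 6d² by 6Ky. The surplus on the left is exactly Ky.
  absurd : 119 * (K * y) + 30 * (y * d) + K * y ≤ 119 * (K * y) + 30 * (y * d)
  absurd = begin
    119 * (K * y) + 30 * (y * d) + K * y ≡⟨ e₁ K y d ⟩
    60 * (2 * (K * y)) + 30 * (y * d) ≤⟨ +-monoˡ-≤ (30 * (y * d)) (*-monoʳ-≤ 60 (am-gm K y)) ⟩
    60 * (K * K + y * y) + 30 * (y * d) ≡⟨ e₂ K y d ⟩
    6 * (10 * (K * K)) + (60 * (y * y) + 30 * (y * d))
      ≤⟨ +-monoˡ-≤ (60 * (y * y) + 30 * (y * d)) (*-monoʳ-≤ 6 main′) ⟩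
    6 * (8 * (K * y) + 4 * (K * d) + d * d + 5 * (y * s)) + (60 * (y * y) + 30 * (y * d)) ≡⟨ e₃ K y d s ⟩
    (48 * (K * y) + 6 * (4 * K * d) + 6 * (d * d)) + 5 * y * (12 * y + 6 * d + 6 * s)
      ≤⟨ +-mono-≤ (+-mono-≤ (+-monoʳ-≤ (48 * (K * y)) (*-monoʳ-≤ 6 (*-monoˡ-≤ d K≤y))) (*-monoʳ-≤ 6 (*-mono-≤ d≤K d≤y)))
                  (*-monoʳ-≤ (5 * y) budget) ⟩
    (48 * (K * y) + 6 * (5 * y * d) + 6 * (K * y)) + 5 * y * (13 * K) ≡⟨ e₄ K y d ⟩
    119 * (K * y) + 30 * (y * d) ∎
    where
    e₁ : ∀ K y d → 119 * (K * y) + 30 * (y * d) + K * y ≡ 60 * (2 * (K * y)) + 30 * (y * d)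
    e₁ = solve-∀
    e₂ : ∀ K y d → 60 * (K * K + y * y) + 30 * (y * d) ≡ 6 * (10 * (K * K)) + (60 * (y * y) + 30 * (y * d))
    e₂ = solve-∀
    e₃ : ∀ K y d s → 6 * (8 * (K * y) + 4 * (K * d) + d * d + 5 * (y * s)) + (60 * (y * y) + 30 * (y * d)) ≡
                     (48 * (K * y) + 6 * (4 * K * d) + 6 * (d * d)) + 5 * y * (12 * y + 6 * d + 6 * s)
    e₃ = solve-∀
    e₄ : ∀ K y d → (48 * (K * y) + 6 * (5 * y * d) + 6 * (K * y)) + 5 * y * (13 * K) ≡ 119 * (K * y) + 30 * (y * d)
    e₄ = solve-∀
  short : 119 * (K * y) + 30 * (y * d) < 119 * (K * y) + 30 * (y * d) + K * y
  short = m<m+n _ (*-mono-≤ 0<K 0<y)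

-- The ordered pairs of distinct elements of an a-element set; their expected number involves no
-- diagonal terms.
pairs : ℕ → ℕ
pairs a = a * (a ∸ 1)

square : ∀ a → a * a ≡ pairs a + a
square zero    = refl
square (suc a) = e a
  where
  e : ∀ a → suc a * suc a ≡ suc a * a + suc a
  e = solve-∀

pairs-≤ : ∀ a → pairs a ≤ a * a
pairs-≤ a = *-monoʳ-≤ a (m∸n≤m a 1)

2≤pairs : ∀ {a} → 2 ≤ a → 2 ≤ pairs a
2≤pairs {suc (suc a)} (s≤s (s≤s _)) = *-mono-≤ {2} {suc (suc a)} {1} {suc a} (s≤s (s≤s z≤n)) (s≤s z≤n)

-- By `square` this amounts to 10 ≤ 3(a + b) + (a - b)² + 5r, with equality at (a, b, r) = (2, 0,
-- 0), (2, 1, 0) and (0, 0, 2). The form with `pairs` and a product can be averaged knowing only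
-- first and second moments.
two-large-classes : ∀ a b r → 2 ≤ a ⊎ 2 ≤ b ⊎ 2 ≤ r →
  10 + 2 * (a * b) ≤ 4 * (a + b) + (pairs a + pairs b) + 5 * r
two-large-classes a b r large = ≤-trans (bound large) (≤-reflexive (regroup a b))
  where
  open ≤-Reasoning
  regroup : ∀ a b → 3 * (a + b) + (a * a + b * b) + 5 * r ≡ 4 * (a + b) + (pairs a + pairs b) + 5 * r
  regroup a b = trans (cong₂ (λ x y → 3 * (a + b) + (x + y) + 5 * r) (square a) (square b)) (e a b (pairs a) (pairs b) r)
    where
    e : ∀ a b x y r → 3 * (a + b) + ((x + a) + (y + b)) + 5 * r ≡ 4 * (a + b) + (x + y) + 5 * r
    e = solve-∀
  first : ∀ a b → 10 + 2 * (suc (suc a) * b) ≤ 3 * (suc (suc a) + b) + (suc (suc a) * suc (suc a) + b * b)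
  first a zero = subst₂ _≤_ (e₁ a) (e₂ a) (m≤m+n 10 (7 * a + a * a))
    where
    e₁ : ∀ a → 10 ≡ 10 + 2 * (suc (suc a) * 0)
    e₁ = solve-∀
    e₂ : ∀ a → 10 + (7 * a + a * a) ≡ 3 * (suc (suc a) + 0) + (suc (suc a) * suc (suc a) + 0 * 0)
    e₂ = solve-∀
  first a (suc zero) = subst₂ _≤_ (e₁ a) (e₂ a) (m≤m+n (14 + 2 * a) (5 * a + a * a))
    where
    e₁ : ∀ a → 14 + 2 * a ≡ 10 + 2 * (suc (suc a) * 1)
    e₁ = solve-∀
    e₂ : ∀ a → 14 + 2 * a + (5 * a + a * a) ≡ 3 * (suc (suc a) + 1) + (suc (suc a) * suc (suc a) + 1 * 1)
    e₂ = solve-∀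
  first a (suc (suc b)) = subst₂ _≤_ (e₁ a b) (e₂ a b)
    (+-mono-≤ (m≤m+n (18 + 4 * a + 4 * b) (2 + 3 * a + 3 * b)) (am-gm a b))
    where
    e₁ : ∀ a b → 18 + 4 * a + 4 * b + 2 * (a * b) ≡ 10 + 2 * (suc (suc a) * suc (suc b))
    e₁ = solve-∀
    e₂ : ∀ a b → 18 + 4 * a + 4 * b + (2 + 3 * a + 3 * b) + (a * a + b * b) ≡
                 3 * (suc (suc a) + suc (suc b)) + (suc (suc a) * suc (suc a) + suc (suc b) * suc (suc b))
    e₂ = solve-∀
  large-first : ∀ a b → 2 ≤ a → 10 + 2 * (a * b) ≤ 3 * (a + b) + (a * a + b * b)
  large-first (suc (suc a)) b (s≤s (s≤s _)) = first a b
  bound : 2 ≤ a ⊎ 2 ≤ b ⊎ 2 ≤ r → 10 + 2 * (a * b) ≤ 3 * (a + b) + (a * a + b * b) + 5 * r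
  bound (inj₁ 2≤a) = m≤n⇒m≤n+o (5 * r) (large-first a b 2≤a)
  bound (inj₂ (inj₁ 2≤b)) = m≤n⇒m≤n+o (5 * r)
    (subst₂ _≤_ (cong (λ z → 10 + 2 * z) (*-comm b a)) (e a b) (large-first b a 2≤b))
    where
    e : ∀ a b → 3 * (b + a) + (b * b + a * a) ≡ 3 * (a + b) + (a * a + b * b)
    e = solve-∀
  bound (inj₂ (inj₂ 2≤r)) = begin
    10 + 2 * (a * b) ≤⟨ +-mono-≤ (*-monoʳ-≤ 5 2≤r) (am-gm a b) ⟩
    5 * r + (a * a + b * b) ≤⟨ m≤n+m (5 * r + (a * a + b * b)) (3 * (a + b)) ⟩
    3 * (a + b) + (5 * r + (a * a + b * b)) ≡⟨ e a b r ⟩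
    3 * (a + b) + (a * a + b * b) + 5 * r ∎
    where
    e : ∀ a b r → 3 * (a + b) + (5 * r + (a * a + b * b)) ≡ 3 * (a + b) + (a * a + b * b) + 5 * r
    e = solve-∀

-- Moments of pairwise independent indicators, and averaging over pencils.

∑-first-moment : ∀ {Ω : Set} (ωs : List Ω) {P} (κ : Fin P → ℕ) (χ : Ω → Fin P → ℕ) X →
  (∀ x → ∑[ ω ← ωs ] χ ω x ≡ X) →
  ∑[ ω ← ωs ] ∑[ x ← allFin P ] (κ x * χ ω x) ≡ ∑ (allFin P) κ * X
∑-first-moment ωs {P} κ χ X first =
  trans (∑-comm ωs (allFin P) (λ ω x → κ x * χ ω x))
  (trans (∑-cong (allFin P) λ x → trans (sym (∑-*ˡ (κ x) ωs (λ ω → χ ω x))) (cong (κ x *_) (first x)))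
  (sym (∑-*ʳ X (allFin P) κ)))

-- The second moments of pairwise independent indicators; the diagonal is moved so that no
-- subtraction occurs.
∑-second-moment : ∀ {Ω : Set} (ωs : List Ω) {P} (κ μ : Fin P → ℕ) (χ : Ω → Fin P → ℕ) X Y →
  (∀ x → ∑[ ω ← ωs ] (χ ω x * χ ω x) ≡ X) → (∀ {x y} → x ≢ y → ∑[ ω ← ωs ] (χ ω x * χ ω y) ≡ Y) →
  (∑[ ω ← ωs ] ((∑[ x ← allFin P ] (κ x * χ ω x)) * (∑[ y ← allFin P ] (μ y * χ ω y))))
    + (∑[ x ← allFin P ] (κ x * μ x)) * Y
  ≡ ∑ (allFin P) κ * ∑ (allFin P) μ * Y + (∑[ x ← allFin P ] (κ x * μ x)) * X
∑-second-moment ωs {P} κ μ χ X Y first second =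
  trans (cong₂ _+_ offdiagonal (diagonal Y))
  (trans (merge _ _)
  (trans (∑-cong I λ x → ∑-cong I λ y → trans (sym (*-distribˡ-+ (κ x * μ y) _ _))
                        (trans (cong (κ x * μ y *_) (pointwise x y)) (*-distribˡ-+ (κ x * μ y) _ _)))
  (trans (sym (merge _ _)) (cong₂ _+_ constant (sym (diagonal X))))))
  where
  I : List (Fin P)
  I = allFin P
  W : Fin P → Fin P → ℕ
  W x y = ∑[ ω ← ωs ] (χ ω x * χ ω y)
  merge : ∀ (f g : Fin P → Fin P → ℕ) →
    (∑[ x ← I ] ∑[ y ← I ] f x y) + (∑[ x ← I ] ∑[ y ← I ] g x y) ≡ ∑[ x ← I ] ∑[ y ← I ] (f x y + g x y)
  merge f g = sym (trans (∑-cong I λ x → ∑-+ I (f x) (g x)) (∑-+ I _ _))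
  interchange : ∀ a b c d → a * b * (c * d) ≡ a * c * (b * d)
  interchange = solve-∀
  offdiagonal : ∑[ ω ← ωs ] ((∑[ x ← I ] (κ x * χ ω x)) * (∑[ y ← I ] (μ y * χ ω y)))
              ≡ ∑[ x ← I ] ∑[ y ← I ] (κ x * μ y * W x y)
  offdiagonal =
    trans (∑-cong ωs λ ω → trans (∑-*-∑ I I _ _) (∑-cong I λ x → ∑-cong I λ y → interchange (κ x) (χ ω x) (μ y) (χ ω y)))
    (trans (∑-comm ωs I _) (∑-cong I λ x → trans (∑-comm ωs I _) (∑-cong I λ y → sym (∑-*ˡ (κ x * μ y) ωs _))))
  diagonal : ∀ Z → (∑[ x ← I ] (κ x * μ x)) * Z ≡ ∑[ x ← I ] ∑[ y ← I ] (κ x * μ y * (𝟙 (y Fin.≟ x) * Z))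
  diagonal Z = trans (∑-*ʳ Z I _) (∑-cong I λ x → sym
    (trans (∑-cong I λ y → e (κ x) (μ y) (𝟙 (y Fin.≟ x)) Z) (∑-δ x (λ y → κ x * μ y * Z))))
    where
    e : ∀ a b d z → a * b * (d * z) ≡ d * (a * b * z)
    e = solve-∀
  pointwise : ∀ x y → W x y + 𝟙 (y Fin.≟ x) * Y ≡ Y + 𝟙 (y Fin.≟ x) * X
  pointwise x y with y Fin.≟ x
  ... | yes refl = trans (cong₂ _+_ (first x) (*-identityˡ Y)) (trans (+-comm X Y) (cong (Y +_) (sym (*-identityˡ X))))
  ... | no y≢x   = cong (_+ 0) (second (y≢x ∘ sym))
  constant : ∑[ x ← I ] ∑[ y ← I ] (κ x * μ y * Y) ≡ ∑ I κ * ∑ I μ * Y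
  constant = sym (trans (cong (_* Y) (∑-*-∑ I I κ μ)) (trans (∑-*ʳ Y I _) (∑-cong I λ x → ∑-*ʳ Y I _)))

-- A family of pencils ω ↦ (H ω u)ᵤ of sets of points: for every u the events x ∈ H ω u are
-- pairwise independent of probability 1/K, the base of a pencil contains a given point with
-- probability 1/(qK), and outside the base the members of a pencil are disjoint.
module PencilColouring
  {Ω U : Set} (ωs : List Ω) (us : List U) (u₀ : U) (P : ℕ)
  (H : Ω → U → Fin P → Set) (H? : ∀ ω u x → Dec (H ω u x))
  (Base : Ω → Fin P → Set) (Base? : ∀ ω x → Dec (Base ω x))
  (q K Y : ℕ) (0<K : 0 < K) (0<Y : 0 < Y) (13≤q : 13 ≤ q)
  (t≤K : 12 * length us ≤ 13 * K) (t≤P : 2 * length us ≤ P)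
  (first : ∀ u x → ∑[ ω ← ωs ] 𝟙 (H? ω u x) ≡ K * Y)
  (second : ∀ u {x y} → x ≢ y → ∑[ ω ← ωs ] (𝟙 (H? ω u x) * 𝟙 (H? ω u y)) ≡ Y)
  (base : ∀ x → q * (∑[ ω ← ωs ] 𝟙 (Base? ω x)) ≡ K * Y)
  (total : length ωs ≡ K * K * Y)
  (disjoint : ∀ ω x → ¬ Base ω x → ∑[ u ← us ] 𝟙 (H? ω u x) ≤ 1)
  where

  private
    t : ℕ
    t = length us
    I : List (Fin P)
    I = allFin P

  module Colouring {n : ℕ} (colour : Fin P → Fin (suc (suc n))) (onto : ∀ j → ∃ λ x → colour x ≡ j)
    (repeated : ∀ ω u → ∃ λ x → ∃ λ y → x ≢ y × H ω u x × H ω u y × colour x ≡ colour y)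
    where

    κ : Fin (suc (suc n)) → Fin P → ℕ
    κ j x = 𝟙 (colour x Fin.≟ j)

    c : Fin (suc (suc n)) → ℕ
    c j = ∑ I (κ j)

    a : Ω → U → Fin (suc (suc n)) → ℕ
    a ω u j = ∑[ x ← I ] (κ j x * 𝟙 (H? ω u x))

    ∑-c : ∑ (allFin (suc (suc n))) c ≡ P
    ∑-c = trans (∑-comm (allFin _) I κ) (trans (∑-cong I λ x →
      trans (∑-cong (allFin _) λ j → trans (𝟙-cong (colour x Fin.≟ j) (j Fin.≟ colour x) sym sym) (sym (*-identityʳ _)))
            (∑-δ (colour x) (const 1)))
      (∑-allFin-1 P))

    κ-disjoint : ∀ {i j} → i ≢ j → ∑[ x ← I ] (κ i x * κ j x) ≡ 0
    κ-disjoint {i} {j} i≢j = trans (∑-cong I pointwise) (∑-zero I)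
      where
      pointwise : ∀ x → κ i x * κ j x ≡ 0
      pointwise x with colour x Fin.≟ i
      ... | yes refl = trans (*-identityˡ _) (𝟙-false (colour x Fin.≟ j) i≢j)
      ... | no _     = refl

    ∑-a : ∀ u j → ∑[ ω ← ωs ] a ω u j ≡ c j * (K * Y)
    ∑-a u j = ∑-first-moment ωs (κ j) (λ ω → 𝟙 ∘ H? ω u) (K * Y) (first u)

    second-moment : ∀ u i j →
      (∑[ ω ← ωs ] (a ω u i * a ω u j)) + (∑[ x ← I ] (κ i x * κ j x)) * Y
        ≡ c i * c j * Y + (∑[ x ← I ] (κ i x * κ j x)) * (K * Y)
    second-moment u i j = ∑-second-moment ωs (κ i) (κ j) (λ ω → 𝟙 ∘ H? ω u) (K * Y) Y
      (λ x → trans (∑-cong ωs λ ω → 𝟙-idem (H? ω u x)) (first u x)) (second u)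

    ∑-a*a : ∀ u {i j} → i ≢ j → ∑[ ω ← ωs ] (a ω u i * a ω u j) ≡ c i * c j * Y
    ∑-a*a u {i} {j} i≢j = trans (sym (+-identityʳ _))
      (trans (subst (λ z → (∑[ ω ← ωs ] (a ω u i * a ω u j)) + z * Y ≡ c i * c j * Y + z * (K * Y))
                    (κ-disjoint i≢j) (second-moment u i j)) (+-identityʳ _))

    -- Subtracting the first moment from the second removes the diagonal: each ordered pair of
    -- distinct points of colour j lies in `H ω u` for exactly `Y` of the ω.
    ∑-pairs : ∀ u j → ∑[ ω ← ωs ] pairs (a ω u j) ≡ pairs (c j) * Y
    ∑-pairs u j = +-cancelʳ-≡ (c j * (K * Y) + c j * Y) _ _
      (trans (sym (+-assoc _ (c j * (K * Y)) (c j * Y)))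
      (trans (cong (_+ c j * Y) (trans (cong ((∑[ ω ← ωs ] pairs (a ω u j)) +_) (sym (∑-a u j)))
                                (trans (sym (∑-+ ωs _ _)) (∑-cong ωs λ ω → sym (square (a ω u j))))))
      (trans (subst (λ z → (∑[ ω ← ωs ] (a ω u j * a ω u j)) + z * Y ≡ c j * c j * Y + z * (K * Y))
                    (∑-cong I λ x → 𝟙-idem (colour x Fin.≟ j)) (second-moment u j j))
      (trans (cong (λ z → z * Y + c j * (K * Y)) (square (c j))) (e (pairs (c j)) (c j) Y (K * Y))))))
      where
      e : ∀ p d y z → (p + d) * y + d * z ≡ p * y + (d * z + d * y)
      e = solve-∀

    2≤a : ∀ ω u → ∃ λ j → 2 ≤ a ω u j
    2≤a ω u with repeated ω u
    ... | x , y , x≢y , x∈ , y∈ , same = colour x ,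
      subst (_≤ a ω u (colour x)) (cong₂ _+_ (one refl x∈) (one (sym same) y∈))
        (f+f≤∑ (λ z → κ (colour x) z * 𝟙 (H? ω u z)) x≢y)
      where
      one : ∀ {z} → colour z ≡ colour x → H ω u z → κ (colour x) z * 𝟙 (H? ω u z) ≡ 1
      one {z} z∼x z∈ = cong₂ _*_ (𝟙-true (colour z Fin.≟ colour x) z∼x) (𝟙-true (H? ω u z) z∈)

    1≤c : ∀ j → 1 ≤ c j
    1≤c j with onto j
    ... | x , refl = ≤-trans (≤-reflexive (sym (𝟙-true (colour x Fin.≟ colour x) refl))) (f≤∑ (κ (colour x)) (∈-allFin x))

    j₁ : Fin (suc (suc n))
    j₁ = proj₁ (argmax c)

    other : Fin (suc n) → Fin (suc (suc n))
    other = punchIn j₁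

    i₂ : Fin (suc n)
    i₂ = proj₁ (argmax (c ∘ other))

    j₂ : Fin (suc (suc n))
    j₂ = other i₂

    rest : Fin n → Fin (suc (suc n))
    rest = other ∘ punchIn i₂

    S : ℕ
    S = ∑[ i ← allFin n ] (c (rest i) ∸ 1)

    c₂≤c₁ : c j₂ ≤ c j₁
    c₂≤c₁ = proj₂ (argmax c) j₂

    class-sizes : c j₁ + (c j₂ + (n + S)) ≡ P
    class-sizes = trans (cong (λ z → c j₁ + (c j₂ + z)) ∑-rest)
      (trans (cong (c j₁ +_) (sym (∑-punchIn i₂ (c ∘ other)))) (trans (sym (∑-punchIn j₁ c)) ∑-c))
      where
      ∑-rest : n + S ≡ ∑[ i ← allFin n ] c (rest i)
      ∑-rest = trans (cong (_+ S) (sym (∑-allFin-1 n)))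
        (trans (sym (∑-+ (allFin n) (const 1) _)) (∑-cong (allFin n) λ i → m+[n∸m]≡n (1≤c (rest i))))

    -- In each product c_j (c_j - 1) the first factor is at most the size of the second largest
    -- class.
    ∑-pairs-rest : ∑[ i ← allFin n ] pairs (c (rest i)) ≤ c j₂ * S
    ∑-pairs-rest = ≤-trans (∑-mono (allFin n) λ i → *-monoˡ-≤ (c (rest i) ∸ 1) (proj₂ (argmax (c ∘ other)) (punchIn i₂ i)))
      (≤-reflexive (sym (∑-*ˡ (c j₂) (allFin n) _)))

    -- A repetition of the largest colour contributes 2 to the first term; a repetition of another
    -- colour contributes two ordered pairs to the second.
    pencil-member : ∀ ω u → 2 ≤ a ω u j₁ + (∑[ i ← allFin (suc n) ] pairs (a ω u (other i)))
    pencil-member ω u with 2≤a ω u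
    ... | j , 2≤aj with j₁ Fin.≟ j
    ...   | yes refl = m≤n⇒m≤n+o _ 2≤aj
    ...   | no j₁≢j = m≤n⇒m≤o+n (a ω u j₁) (≤-trans (2≤pairs (subst (λ z → 2 ≤ a ω u z) (sym (Fin.punchIn-punchOut j₁≢j)) 2≤aj))
                      (f≤∑ (λ i → pairs (a ω u (other i))) (∈-allFin (punchOut j₁≢j))))

    two-classes : ∀ ω u → 10 + 2 * (a ω u j₁ * a ω u j₂) ≤
      4 * (a ω u j₁ + a ω u j₂) + (pairs (a ω u j₁) + pairs (a ω u j₂)) + 5 * (∑[ i ← allFin n ] pairs (a ω u (rest i)))
    two-classes ω u = two-large-classes (a ω u j₁) (a ω u j₂) _ large
      where
      large : 2 ≤ a ω u j₁ ⊎ 2 ≤ a ω u j₂ ⊎ 2 ≤ (∑[ i ← allFin n ] pairs (a ω u (rest i)))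
      large with 2≤a ω u
      ... | j , 2≤aj with j₁ Fin.≟ j
      ...   | yes refl = inj₁ 2≤aj
      ...   | no j₁≢j with i₂ Fin.≟ punchOut j₁≢j
      ...     | yes e = inj₂ (inj₁ (subst (λ z → 2 ≤ a ω u z) (sym (trans (cong other e) (Fin.punchIn-punchOut j₁≢j))) 2≤aj))
      ...     | no i₂≢ = inj₂ (inj₂ (≤-trans
        (2≤pairs (subst (λ z → 2 ≤ a ω u z) (sym (trans (cong other (Fin.punchIn-punchOut i₂≢)) (Fin.punchIn-punchOut j₁≢j))) 2≤aj))
        (f≤∑ (λ i → pairs (a ω u (rest i))) (∈-allFin (punchOut i₂≢)))))

    -- An upper bound, with known mean, for the indicator of the event that the base meets the
    -- largest class.
    z : Ω → ℕ
    z ω = ∑[ x ← I ] (κ j₁ x * 𝟙 (Base? ω x))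

    ∑-z : q * ∑ ωs z ≡ c j₁ * (K * Y)
    ∑-z = trans (cong (q *_) (∑-comm ωs I _)) (trans (∑-*ˡ q I _)
      (trans (∑-cong I λ x → trans (cong (q *_) (sym (∑-*ˡ (κ j₁ x) ωs _)))
        (trans (e q (κ j₁ x) _) (cong (κ j₁ x *_) (base x)))) (sym (∑-*ʳ (K * Y) I (κ j₁)))))
      where
      e : ∀ x y z → x * (y * z) ≡ y * (x * z)
      e = solve-∀

    -- When the base misses the largest class, each point of that class lies in at most one member,
    -- so summing `pencil-member` over `us` yields at most `c j₁` from its first terms.
    pencil : ∀ ω → z ω ≡ 0 → 2 * t ≤ c j₁ + (∑[ u ← us ] ∑[ i ← allFin (suc n) ] pairs (a ω u (other i)))
    pencil ω z≡0 = begin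
      2 * t ≡⟨ *-comm 2 t ⟩
      t * 2 ≡⟨ ∑-const us 2 ⟨
      ∑ us (const 2) ≤⟨ ∑-mono us (pencil-member ω) ⟩
      ∑[ u ← us ] (a ω u j₁ + (∑[ i ← allFin (suc n) ] pairs (a ω u (other i)))) ≡⟨ ∑-+ us _ _ ⟩
      (∑[ u ← us ] a ω u j₁) + E ≤⟨ +-monoˡ-≤ E (≤-trans (≤-reflexive (∑-comm us I _)) (∑-mono I inside)) ⟩
      c j₁ + E ∎
      where
      open ≤-Reasoning
      E : ℕ
      E = ∑[ u ← us ] ∑[ i ← allFin (suc n) ] pairs (a ω u (other i))
      inside : ∀ x → ∑[ u ← us ] (κ j₁ x * 𝟙 (H? ω u x)) ≤ κ j₁ x
      inside x with colour x Fin.≟ j₁ in eq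
      ... | no _  = ≤-reflexive (∑-zero us)
      ... | yes _ = ≤-trans (≤-reflexive (∑-cong us λ u → *-identityˡ _)) (disjoint ω x λ x∈ → 1+n≰n (begin
        1 ≡⟨ cong₂ _*_ (cong 𝟙 eq) (𝟙-true (Base? ω x) x∈) ⟨
        κ j₁ x * 𝟙 (Base? ω x) ≤⟨ f≤∑ (λ x → κ j₁ x * 𝟙 (Base? ω x)) (∈-allFin x) ⟩
        z ω ≡⟨ z≡0 ⟩
        0 ∎))

    -- Removes the condition on the base so that all ω can be averaged: when `z ω` is positive, the
    -- term `g * z ω` alone suffices.
    pencil′ : ∀ ω g → g + c j₁ ≤ 2 * t → g ≤ g * z ω + (∑[ u ← us ] ∑[ i ← allFin (suc n) ] pairs (a ω u (other i)))
    pencil′ ω g g≤ with z ω in eq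
    ... | suc _ = m≤n⇒m≤n+o _ (≤-trans (m≤m+n g _) (≤-reflexive (sym (*-suc g _))))
    ... | zero  = m≤n⇒m≤o+n (g * 0) (+-cancelˡ-≤ (c j₁) g _ (≤-trans (≤-reflexive (+-comm (c j₁) g)) (≤-trans g≤ (pencil ω eq))))

    too-many-colours : suc (suc P) ≤ suc (suc n) + 2 * t → ⊥
    too-many-colours hyp = no-large-classes K t (c j₁) (c j₂) S 0<K t≤K c₂-large c₂≤c₁ budget
      (*-cancelʳ-≤ (10 * (K * K) + 2 * (c j₁ * c j₂)) (4 * (K * (c j₁ + c j₂)) + (c j₁ * c j₁ + c j₂ * c j₂) + 5 * (c j₂ * S)) Y summed)
      where
      open ≤-Reasoning
      instance
        Y≢0 : NonZero Y
        Y≢0 = >-nonZero 0<Y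
      -- `hyp` amounts to P ≤ n + 2t; cancelling one point for each of the n remaining colours in
      -- `class-sizes` leaves this bound.
      budget : c j₁ + c j₂ + S ≤ 2 * t
      budget = +-cancelˡ-≤ n _ _ (≤-trans (≤-reflexive (trans (e n (c j₁) (c j₂) S) class-sizes)) (s≤s⁻¹ (s≤s⁻¹ hyp)))
        where
        e : ∀ n x y s → n + (x + y + s) ≡ x + (y + (n + s))
        e = solve-∀
      -- At most 2t - c₁, and at the same time a factor of the bound c₂(c₂ + S) on the ordered pairs
      -- in the classes other than `j₁`; so it cancels after averaging.
      g : ℕ
      g = c j₂ + S
      0<g : 0 < g
      0<g = m≤n⇒m≤n+o S (1≤c j₂)
      c₁+g : c j₁ + g ≤ 2 * t
      c₁+g = ≤-trans (≤-reflexive (sym (+-assoc (c j₁) (c j₂) S))) budget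
      ∑-pairs-other : ∑[ i ← allFin (suc n) ] pairs (c (other i)) ≤ c j₂ * g
      ∑-pairs-other = ≤-trans (≤-reflexive (∑-punchIn i₂ (pairs ∘ c ∘ other)))
        (≤-trans (+-mono-≤ (pairs-≤ (c j₂)) ∑-pairs-rest) (≤-reflexive (sym (*-distribˡ-+ (c j₂) (c j₂) S))))
      ∑-E : ∑[ ω ← ωs ] ∑[ u ← us ] ∑[ i ← allFin (suc n) ] pairs (a ω u (other i)) ≤ t * (c j₂ * g * Y)
      ∑-E = begin
        ∑[ ω ← ωs ] ∑[ u ← us ] ∑[ i ← allFin (suc n) ] pairs (a ω u (other i)) ≡⟨ ∑-comm ωs us _ ⟩
        ∑[ u ← us ] ∑[ ω ← ωs ] ∑[ i ← allFin (suc n) ] pairs (a ω u (other i))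
          ≡⟨ ∑-cong us (λ u → trans (∑-comm ωs (allFin (suc n)) _)
               (trans (∑-cong (allFin (suc n)) λ i → ∑-pairs u (other i)) (sym (∑-*ʳ Y (allFin (suc n)) (pairs ∘ c ∘ other))))) ⟩
        ∑[ u ← us ] ((∑[ i ← allFin (suc n) ] pairs (c (other i))) * Y) ≡⟨ ∑-const us _ ⟩
        t * ((∑[ i ← allFin (suc n) ] pairs (c (other i))) * Y) ≤⟨ *-monoʳ-≤ t (*-monoˡ-≤ Y ∑-pairs-other) ⟩
        t * (c j₂ * g * Y) ∎
      averaged : q * (K * K) * (g * Y) ≤ (c j₁ * K + t * q * c j₂) * (g * Y)
      averaged = begin
        q * (K * K) * (g * Y) ≡⟨ e₁ q K g Y ⟩
        q * (K * K * Y * g) ≡⟨ cong (λ l → q * (l * g)) total ⟨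
        q * (length ωs * g) ≡⟨ cong (q *_) (∑-const ωs g) ⟨
        q * ∑ ωs (const g) ≤⟨ *-monoʳ-≤ q (∑-mono ωs λ ω → pencil′ ω g (≤-trans (≤-reflexive (+-comm g (c j₁))) c₁+g)) ⟩
        q * (∑[ ω ← ωs ] (g * z ω + (∑[ u ← us ] ∑[ i ← allFin (suc n) ] pairs (a ω u (other i))))) ≡⟨ cong (q *_) (∑-+ ωs _ _) ⟩
        q * ((∑[ ω ← ωs ] (g * z ω)) + (∑[ ω ← ωs ] ∑[ u ← us ] ∑[ i ← allFin (suc n) ] pairs (a ω u (other i))))
          ≤⟨ *-monoʳ-≤ q (+-mono-≤ (≤-reflexive (sym (∑-*ˡ g ωs z))) ∑-E) ⟩
        q * (g * ∑ ωs z + t * (c j₂ * g * Y)) ≡⟨ e₂ q g (∑ ωs z) t (c j₂) Y ⟩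
        g * (q * ∑ ωs z) + t * q * c j₂ * (g * Y) ≡⟨ cong (λ s → g * s + t * q * c j₂ * (g * Y)) ∑-z ⟩
        g * (c j₁ * (K * Y)) + t * q * c j₂ * (g * Y) ≡⟨ e₃ q K g Y (c j₁) (c j₂) t ⟩
        (c j₁ * K + t * q * c j₂) * (g * Y) ∎
        where
        e₁ : ∀ q K g Y → q * (K * K) * (g * Y) ≡ q * (K * K * Y * g)
        e₁ = solve-∀
        e₂ : ∀ q g z t d Y → q * (g * z + t * (d * g * Y)) ≡ g * (q * z) + t * q * d * (g * Y)
        e₂ = solve-∀
        e₃ : ∀ q K g Y x y t → g * (x * (K * Y)) + t * q * y * (g * Y) ≡ (x * K + t * q * y) * (g * Y)
        e₃ = solve-∀
      c₂-large : 4 * K ≤ 5 * c j₂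
      c₂-large = second-class-large q K t (c j₁) (c j₂) 13≤q 0<K t≤K
        (m+n≤o⇒m≤o (c j₁ + c j₂) budget)
        (*-cancelʳ-≤ (q * (K * K)) (c j₁ * K + t * q * c j₂) (g * Y) {{>-nonZero (*-mono-≤ 0<g 0<Y)}} averaged)
      ∑-rest : ∑[ ω ← ωs ] ∑[ i ← allFin n ] pairs (a ω u₀ (rest i)) ≤ c j₂ * S * Y
      ∑-rest = ≤-trans (≤-reflexive (trans (∑-comm ωs (allFin n) _) (trans (∑-cong (allFin n) λ i → ∑-pairs u₀ (rest i)) (sym (∑-*ʳ Y (allFin n) (pairs ∘ c ∘ rest))))))
        (*-monoˡ-≤ Y ∑-pairs-rest)
      a₁ a₂ R : Ω → ℕ
      a₁ ω = a ω u₀ j₁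
      a₂ ω = a ω u₀ j₂
      R ω = ∑[ i ← allFin n ] pairs (a ω u₀ (rest i))
      summed : (10 * (K * K) + 2 * (c j₁ * c j₂)) * Y ≤
               (4 * (K * (c j₁ + c j₂)) + (c j₁ * c j₁ + c j₂ * c j₂) + 5 * (c j₂ * S)) * Y
      summed = begin
        (10 * (K * K) + 2 * (c j₁ * c j₂)) * Y ≡⟨ e₁ K Y (c j₁) (c j₂) ⟩
        K * K * Y * 10 + 2 * (c j₁ * c j₂ * Y)
          ≡⟨ cong₂ (λ l p → l * 10 + 2 * p) (sym total) (sym (∑-a*a u₀ (Fin.punchInᵢ≢i j₁ i₂ ∘ sym))) ⟩
        length ωs * 10 + 2 * (∑[ ω ← ωs ] (a₁ ω * a₂ ω)) ≡⟨ cong₂ _+_ (∑-const ωs 10) (sym (∑-*ˡ 2 ωs _)) ⟨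
        ∑ ωs (const 10) + (∑[ ω ← ωs ] (2 * (a₁ ω * a₂ ω))) ≡⟨ ∑-+ ωs _ _ ⟨
        ∑[ ω ← ωs ] (10 + 2 * (a₁ ω * a₂ ω)) ≤⟨ ∑-mono ωs (λ ω → two-classes ω u₀) ⟩
        ∑[ ω ← ωs ] (4 * (a₁ ω + a₂ ω) + (pairs (a₁ ω) + pairs (a₂ ω)) + 5 * R ω)
          ≡⟨ trans (∑-+ ωs _ _) (cong₂ _+_
               (trans (∑-+ ωs _ _) (cong₂ _+_
                 (trans (sym (∑-*ˡ 4 ωs _)) (cong (4 *_) (trans (∑-+ ωs a₁ a₂) (cong₂ _+_ (∑-a u₀ j₁) (∑-a u₀ j₂)))))
                 (trans (∑-+ ωs _ _) (cong₂ _+_ (∑-pairs u₀ j₁) (∑-pairs u₀ j₂)))))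
               (sym (∑-*ˡ 5 ωs R))) ⟩
        4 * (c j₁ * (K * Y) + c j₂ * (K * Y)) + (pairs (c j₁) * Y + pairs (c j₂) * Y) + 5 * ∑ ωs R
          ≤⟨ +-mono-≤ (+-monoʳ-≤ (4 * (c j₁ * (K * Y) + c j₂ * (K * Y)))
               (+-mono-≤ (*-monoˡ-≤ Y (pairs-≤ (c j₁))) (*-monoˡ-≤ Y (pairs-≤ (c j₂))))) (*-monoʳ-≤ 5 ∑-rest) ⟩
        4 * (c j₁ * (K * Y) + c j₂ * (K * Y)) + (c j₁ * c j₁ * Y + c j₂ * c j₂ * Y) + 5 * (c j₂ * S * Y)
          ≡⟨ e₂ K Y (c j₁) (c j₂) S ⟩
        (4 * (K * (c j₁ + c j₂)) + (c j₁ * c j₁ + c j₂ * c j₂) + 5 * (c j₂ * S)) * Y ∎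
        where
        e₁ : ∀ K Y x y → (10 * (K * K) + 2 * (x * y)) * Y ≡ K * K * Y * 10 + 2 * (x * y * Y)
        e₁ = solve-∀
        e₂ : ∀ K Y x y s → 4 * (x * (K * Y) + y * (K * Y)) + (x * x * Y + y * y * Y) + 5 * (y * s * Y) ≡
                           (4 * (K * (x + y)) + (x * x + y * y) + 5 * (y * s)) * Y
        e₂ = solve-∀

  -- With at most one colour the bound is `t≤P`. From two colours on, the two largest classes exist
  -- and an excess of colours is contradictory.
  colour-bound : ∀ {N} (colour : Fin P → Fin N) → (∀ j → ∃ λ x → colour x ≡ j) →
    (∀ ω u → ∃ λ x → ∃ λ y → x ≢ y × H ω u x × H ω u y × colour x ≡ colour y) →
    N + 2 * t ≤ suc P
  colour-bound {zero}        colour onto repeated = m≤n⇒m≤1+n t≤P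
  colour-bound {suc zero}    colour onto repeated = s≤s t≤P
  colour-bound {suc (suc n)} colour onto repeated =
    ≮⇒≥ (Colouring.too-many-colours colour onto repeated)

-- Linear algebra and counting over a finite field.

module LinearAlgebra {q : ℕ} (𝔽 : FiniteField q) where

  module F = FiniteField 𝔽
  open F public using (Carrier; _≈_; 0#; 1#; elements)
    renaming (_+_ to infixl 6 _⊕_; _*_ to infixl 7 _⊗_; -_ to infix 8 ⊖_; _≟_ to infix 4 _≈?_)
  open ≈-Reasoning F.setoid

  private
    module Solver = Algebra.Solver.Ring.NaturalCoefficients.Default F.commutativeSemiring
  open Solver using (solve; _:+_; _:*_; _:=_)

  Vec : ℕ → Set
  Vec m = Fin m → Carrier

  Zero : ∀ {m} → Vec m → Set
  Zero x = ∀ i → x i ≈ 0#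

  +-cancelʳ : ∀ z {x y} → x ⊕ z ≈ y ⊕ z → x ≈ y
  +-cancelʳ z {x} {y} = Algebra.Properties.AbelianGroup.∙-cancelʳ F.+-abelianGroup z x y

  cancel-inverse : ∀ {x x⁻¹} a → x ⊗ x⁻¹ ≈ 1# → a ⊗ x ⊗ x⁻¹ ≈ a
  cancel-inverse {x} {x⁻¹} a inv = begin
    a ⊗ x ⊗ x⁻¹ ≈⟨ F.*-assoc a x x⁻¹ ⟩
    a ⊗ (x ⊗ x⁻¹) ≈⟨ F.*-congˡ inv ⟩
    a ⊗ 1# ≈⟨ F.*-identityʳ a ⟩
    a ∎

  cancel-inverse′ : ∀ {x x⁻¹} a → x ⊗ x⁻¹ ≈ 1# → a ⊗ x⁻¹ ⊗ x ≈ a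
  cancel-inverse′ {x} {x⁻¹} a inv = F.trans (solve 3 (λ a x y → a :* y :* x := a :* x :* y) F.refl a x x⁻¹) (cancel-inverse a inv)

  ⊗-cancelʳ : ∀ {x} a b → ¬ x ≈ 0# → a ⊗ x ≈ b ⊗ x → a ≈ b
  ⊗-cancelʳ {x} a b x≉0 e = let x⁻¹ , inv = F.inverse x x≉0 in
    F.trans (F.sym (cancel-inverse a inv)) (F.trans (F.*-congʳ e) (cancel-inverse b inv))

  ⊗-zero : ∀ {x} a → ¬ x ≈ 0# → a ⊗ x ≈ 0# → a ≈ 0#
  ⊗-zero a x≉0 e = ⊗-cancelʳ a 0# x≉0 (F.trans e (F.sym (F.zeroˡ _)))

  ⊖-⊗ : ∀ a x → a ⊗ x ⊕ ⊖ a ⊗ x ≈ 0#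
  ⊖-⊗ a x = F.trans (F.sym (F.distribʳ x a (⊖ a))) (F.trans (F.*-congʳ (F.-‿inverseʳ a)) (F.zeroˡ x))

  dot : ∀ {m} → Vec m → Vec m → Carrier
  dot {zero}  a x = 0#
  dot {suc m} a x = head a ⊗ head x ⊕ dot (tail a) (tail x)

  dot-cong : ∀ {m} {a b x y : Vec m} → (∀ i → a i ≈ b i) → (∀ i → x i ≈ y i) → dot a x ≈ dot b y
  dot-cong {zero}  p r = F.refl
  dot-cong {suc m} p r = F.+-cong (F.*-cong (p zero) (r zero)) (dot-cong (p ∘ suc) (r ∘ suc))

  dot-zeroʳ : ∀ {m} (a : Vec m) {x} → Zero x → dot a x ≈ 0#
  dot-zeroʳ {zero}  a x≈0 = F.refl
  dot-zeroʳ {suc m} a x≈0 = F.trans (F.+-cong (F.trans (F.*-congˡ (x≈0 zero)) (F.zeroʳ _)) (dot-zeroʳ (tail a) (x≈0 ∘ suc))) (F.+-identityˡ 0#)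

  dot-comm : ∀ {m} (a x : Vec m) → dot a x ≈ dot x a
  dot-comm {zero}  a x = F.refl
  dot-comm {suc m} a x = F.+-cong (F.*-comm _ _) (dot-comm (tail a) (tail x))

  dot-linear : ∀ {m} (a x y : Vec m) c → dot a (λ i → x i ⊕ c ⊗ y i) ≈ dot a x ⊕ c ⊗ dot a y
  dot-linear {zero}  a x y c = F.sym (F.trans (F.+-identityˡ _) (F.zeroʳ c))
  dot-linear {suc m} a x y c = F.trans (F.+-congˡ (dot-linear (tail a) (tail x) (tail y) c))
    (solve 6 (λ a x y c p r → a :* (x :+ c :* y) :+ (p :+ c :* r) := (a :* x :+ p) :+ c :* (a :* y :+ r))
      F.refl (head a) (head x) (head y) c _ _)

  dot-scale : ∀ {m} (a x : Vec m) c → dot a (λ i → c ⊗ x i) ≈ c ⊗ dot a x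
  dot-scale {zero}  a x c = F.sym (F.zeroʳ c)
  dot-scale {suc m} a x c = F.trans (F.+-congˡ (dot-scale (tail a) (tail x) c))
    (solve 4 (λ a x c p → a :* (c :* x) :+ c :* p := c :* (a :* x :+ p)) F.refl (head a) (head x) c _)

  dot-dot : ∀ {m d} (f : Vec m) (a : Vec d) (b : Fin d → Vec m) →
    dot f (λ i → dot a (λ j → b j i)) ≈ dot a (λ j → dot f (b j))
  dot-dot {d = zero}  f a b = dot-zeroʳ f λ i → F.refl
  dot-dot {d = suc d} f a b = begin
    dot f (λ i → head a ⊗ head b i ⊕ dot (tail a) (λ j → tail b j i))
      ≈⟨ dot-cong {a = f} (λ _ → F.refl) (λ i → F.+-comm (head a ⊗ head b i) _) ⟩
    dot f (λ i → dot (tail a) (λ j → tail b j i) ⊕ head a ⊗ head b i)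
      ≈⟨ dot-linear f (λ i → dot (tail a) (λ j → tail b j i)) (head b) (head a) ⟩
    dot f (λ i → dot (tail a) (λ j → tail b j i)) ⊕ head a ⊗ dot f (head b) ≈⟨ F.+-congʳ (dot-dot f (tail a) (tail b)) ⟩
    dot (tail a) (λ j → dot f (tail b j)) ⊕ head a ⊗ dot f (head b) ≈⟨ F.+-comm _ _ ⟩
    head a ⊗ dot f (head b) ⊕ dot (tail a) (λ j → dot f (tail b j)) ∎

  Indep : ∀ {m} → Vec m → Vec m → Set
  Indep x y = ∀ α β → (∀ i → α ⊗ x i ⊕ β ⊗ y i ≈ 0#) → α ≈ 0# × β ≈ 0#

  Indep-sym : ∀ {m} {x y : Vec m} → Indep x y → Indep y x
  Indep-sym ind α β e = let a , b = ind β α (λ i → F.trans (F.+-comm _ _) (e i)) in b , a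

  Indep-nonzero : ∀ {m} {x y : Vec m} → Indep x y → ¬ Zero x
  Indep-nonzero ind x≈0 = F.0≉1 (F.sym (proj₁ (ind 1# 0# λ i →
    F.trans (F.+-cong (F.trans (F.*-congˡ (x≈0 i)) (F.zeroʳ 1#)) (F.zeroˡ _)) (F.+-identityˡ 0#))))

  ∑-solutions : ∀ {x} → ¬ x ≈ 0# → ∀ v s → ∑[ a ← elements ] 𝟙 (a ⊗ x ⊕ v ≈? s) ≡ 1
  ∑-solutions {x} x≉0 v s = ∑𝟙-unique (λ a → a ⊗ x ⊕ v ≈? s)
    (AllPairs.map (λ {a} {b} a≉b p r → a≉b (⊗-cancelʳ a b x≉0 (+-cancelʳ v (F.trans p (F.sym r))))) F.enum-distinct)
    (Any.map solved (F.enum-complete ((s ⊕ ⊖ v) ⊗ x⁻¹)))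
    where
    x⁻¹ = proj₁ (F.inverse x x≉0)
    solved : ∀ {a} → (s ⊕ ⊖ v) ⊗ x⁻¹ ≈ a → a ⊗ x ⊕ v ≈ s
    solved {a} e = begin
      a ⊗ x ⊕ v ≈⟨ F.+-congʳ (F.*-congʳ e) ⟨
      (s ⊕ ⊖ v) ⊗ x⁻¹ ⊗ x ⊕ v ≈⟨ F.+-congʳ (cancel-inverse′ _ (proj₂ (F.inverse x x≉0))) ⟩
      s ⊕ ⊖ v ⊕ v ≈⟨ F.+-assoc s (⊖ v) v ⟩
      s ⊕ (⊖ v ⊕ v) ≈⟨ F.+-congˡ (F.-‿inverseˡ v) ⟩
      s ⊕ 0# ≈⟨ F.+-identityʳ s ⟩
      s ∎

  vectors : ∀ m → List (Vec m)
  vectors = tuples elements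

  length-vectors : ∀ m → length (vectors m) ≡ q ^ m
  length-vectors m = trans (length-tuples elements m) (cong (_^ m) F.enum-length)

  ∑-vectors-suc : ∀ m f → ∑ (vectors (suc m)) f ≡ ∑[ a ← elements ] ∑[ r ← vectors m ] f (a Vector.∷ r)
  ∑-vectors-suc m = ∑-cartesianProductWith Vector._∷_ elements (vectors m)

  ∑-elements-const : ∀ c → ∑ elements (const c) ≡ q * c
  ∑-elements-const c = trans (∑-const elements c) (cong (_* c) F.enum-length)

  -- If the first coordinate of x is nonzero, the other coordinates of r determine its first one;
  -- otherwise that coordinate is free and the count reduces to `tail x`. The factor `q` avoids the
  -- exponent m - 1.
  count-hyperplane : ∀ {m} (x : Vec m) s → ¬ Zero x → q * (∑[ r ← vectors m ] 𝟙 (dot r x ≈? s)) ≡ q ^ m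
  count-hyperplane {zero}  x s x≉0 = contradiction (λ ()) x≉0
  count-hyperplane {suc m} x s x≉0 with head x ≈? 0#
  ... | no x₀≉0 = cong (q *_) (trans (∑-vectors-suc m _) (trans (∑-comm elements (vectors m) _)
          (trans (∑-cong (vectors m) λ r → ∑-solutions x₀≉0 (dot r (tail x)) s) (trans (length-∑ (vectors m)) (length-vectors m)))))
  ... | yes x₀≈0 = cong (q *_) (trans (∑-vectors-suc m _)
          (trans (∑-cong elements λ a → ∑-cong (vectors m) λ r → 𝟙-cong (dot (a Vector.∷ r) x ≈? s) (dot r (tail x) ≈? s)
            (F.trans (F.sym (drop a r))) (F.trans (drop a r)))
          (trans (∑-elements-const _) (count-hyperplane (tail x) s λ tx≈0 → x≉0 λ { zero → x₀≈0 ; (suc i) → tx≈0 i }))))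
    where
    drop : ∀ a r → a ⊗ head x ⊕ dot r (tail x) ≈ dot r (tail x)
    drop a r = F.trans (F.+-congʳ (F.trans (F.*-congˡ x₀≈0) (F.zeroʳ a))) (F.+-identityˡ _)

  count-pair : ∀ {m} (x y : Vec m) s t → Vec m → ℕ
  count-pair x y s t r = 𝟙 (dot r x ≈? s) * 𝟙 (dot r y ≈? t)

  -- Eliminating the first coordinate of x by means of y decouples the two conditions.
  count-codim-two-pivot : ∀ {m} (x y : Vec (suc m)) s t → ¬ head y ≈ 0# → Indep x y →
    q * (q * ∑ (vectors (suc m)) (count-pair x y s t)) ≡ q ^ suc m
  count-codim-two-pivot {m} x y s t y₀≉0 ind = cong (q *_)
    (trans (cong (q *_) (trans (∑-vectors-suc m _) (trans (∑-comm elements (vectors m) _) (∑-cong (vectors m) decoupled))))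
           (count-hyperplane x′ (s ⊕ μ ⊗ t) x′≉0))
    where
    y₀⁻¹ μ : Carrier
    y₀⁻¹ = proj₁ (F.inverse (head y) y₀≉0)
    μ = ⊖ (head x ⊗ y₀⁻¹)
    x′ : Vec m
    x′ i = x (suc i) ⊕ μ ⊗ y (suc i)
    head≈0 : head x ⊕ μ ⊗ head y ≈ 0#
    head≈0 = F.trans (F.+-congʳ (F.sym (cancel-inverse′ (head x) (proj₂ (F.inverse (head y) y₀≉0))))) (⊖-⊗ _ (head y))
    x′≉0 : ¬ Zero x′
    x′≉0 x′≈0 = F.0≉1 (F.sym (proj₁ (ind 1# μ λ
      { zero → F.trans (F.+-congʳ (F.*-identityˡ _)) head≈0
      ; (suc i) → F.trans (F.+-congʳ (F.*-identityˡ _)) (x′≈0 i) })))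
    eliminate : ∀ a r → dot (a Vector.∷ r) x ⊕ μ ⊗ dot (a Vector.∷ r) y ≈ dot r x′
    eliminate a r = F.trans (F.sym (dot-linear (a Vector.∷ r) x y μ))
      (F.trans (F.+-congʳ (F.trans (F.*-congˡ head≈0) (F.zeroʳ a))) (F.+-identityˡ _))
    split : ∀ a r → count-pair x y s t (a Vector.∷ r) ≡ 𝟙 (dot r x′ ≈? s ⊕ μ ⊗ t) * 𝟙 (a ⊗ head y ⊕ dot r (tail y) ≈? t)
    split a r = trans (𝟙-× (dot (a Vector.∷ r) x ≈? s) (dot (a Vector.∷ r) y ≈? t))
      (trans (𝟙-cong (dot (a Vector.∷ r) x ≈? s ×-dec dot (a Vector.∷ r) y ≈? t) (dot r x′ ≈? s ⊕ μ ⊗ t ×-dec dot (a Vector.∷ r) y ≈? t)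
        (λ (p , p′) → F.trans (F.sym (eliminate a r)) (F.+-cong p (F.*-congˡ p′)) , p′)
        (λ (p , p′) → +-cancelʳ (μ ⊗ t) (F.trans (F.+-congˡ (F.*-congˡ (F.sym p′))) (F.trans (eliminate a r) p)) , p′))
      (sym (𝟙-× (dot r x′ ≈? s ⊕ μ ⊗ t) (dot (a Vector.∷ r) y ≈? t))))
    decoupled : ∀ r → ∑[ a ← elements ] count-pair x y s t (a Vector.∷ r) ≡ 𝟙 (dot r x′ ≈? s ⊕ μ ⊗ t)
    decoupled r = trans (∑-cong elements λ a → split a r) (trans (sym (∑-*ˡ (𝟙 (dot r x′ ≈? s ⊕ μ ⊗ t)) elements _))
      (trans (cong (𝟙 (dot r x′ ≈? s ⊕ μ ⊗ t) *_) (∑-solutions y₀≉0 (dot r (tail y)) t)) (*-identityʳ _)))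

  -- Pivot on a nonzero first coordinate of either vector. If both vanish, the first coordinate of r
  -- is free and the tails are still independent.
  count-codim-two : ∀ {m} (x y : Vec m) s t → Indep x y → q * (q * ∑ (vectors m) (count-pair x y s t)) ≡ q ^ m
  count-codim-two {zero}  x y s t ind = contradiction (λ ()) (Indep-nonzero ind)
  count-codim-two {suc m} x y s t ind with head x ≈? 0# | head y ≈? 0#
  ... | _ | no y₀≉0 = count-codim-two-pivot x y s t y₀≉0 ind
  ... | no x₀≉0 | _ = trans (cong (λ z → q * (q * z)) (∑-cong (vectors (suc m)) λ r → *-comm (𝟙 (dot r x ≈? s)) _))
                            (count-codim-two-pivot y x t s x₀≉0 (Indep-sym ind))
  ... | yes x₀≈0 | yes y₀≈0 = cong (q *_) (trans (cong (q *_) (trans (∑-vectors-suc m _)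
          (trans (∑-cong elements λ a → ∑-cong (vectors m) λ r → cong₂ _*_ (drop x s x₀≈0 a r) (drop y t y₀≈0 a r)) (∑-elements-const _))))
          (count-codim-two (tail x) (tail y) s t λ α β e → ind α β λ { zero → zeros α β ; (suc i) → e i }))
    where
    drop : ∀ x s → head x ≈ 0# → ∀ a r → 𝟙 (a ⊗ head x ⊕ dot r (tail x) ≈? s) ≡ 𝟙 (dot r (tail x) ≈? s)
    drop x s x₀≈0 a r = 𝟙-cong (a ⊗ head x ⊕ dot r (tail x) ≈? s) (dot r (tail x) ≈? s) (F.trans (F.sym e)) (F.trans e)
      where
      e : a ⊗ head x ⊕ dot r (tail x) ≈ dot r (tail x)
      e = F.trans (F.+-congʳ (F.trans (F.*-congˡ x₀≈0) (F.zeroʳ a))) (F.+-identityˡ _)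
    zeros : ∀ α β → α ⊗ head x ⊕ β ⊗ head y ≈ 0#
    zeros α β = F.trans (F.+-cong (F.trans (F.*-congˡ x₀≈0) (F.zeroʳ α)) (F.trans (F.*-congˡ y₀≈0) (F.zeroʳ β))) (F.+-identityˡ 0#)

  Independent : ∀ {m d} → (Fin d → Vec m) → Set
  Independent {d = d} b = ∀ (a : Vec d) → (∀ i → dot a (λ j → b j i) ≈ 0#) → Zero a

  unit : ∀ {m} → Fin m → Vec m
  unit zero    = 1# Vector.∷ const 0#
  unit (suc i) = 0# Vector.∷ unit i

  dot-unit : ∀ {m} (a : Vec m) i → dot a (λ j → unit j i) ≈ a i
  dot-unit a zero    = F.trans (F.+-cong (F.*-identityʳ _) (dot-zeroʳ (tail a) λ i → F.refl)) (F.+-identityʳ _)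
  dot-unit a (suc i) = F.trans (F.+-cong (F.zeroʳ _) (dot-unit (tail a) i)) (F.+-identityˡ _)

  unit-independent : ∀ {m} → Independent (unit {m})
  unit-independent a e i = F.trans (F.sym (dot-unit a i)) (e i)

  -- For nonzero β divide by a nonzero entry; for β = 0 the zero multipliers work. This spares
  -- `eliminate-form` a case distinction.
  pivot : ∀ {d} (β : Vec (suc d)) → ∃ λ p → ∃ λ (γ : Vec d) → ∀ j → β (punchIn p j) ≈ γ j ⊗ β p
  pivot β with Fin.any? (λ p → ¬? (β p ≈? 0#))
  ... | yes (p , βp≉0) = let β⁻¹ , inv = F.inverse (β p) βp≉0 in
    p , (λ j → β (punchIn p j) ⊗ β⁻¹) , λ j → F.sym (cancel-inverse′ _ inv)
  ... | no none = zero , const 0# , λ j → F.trans (decidable-stable (β (suc j) ≈? 0#) λ n → none (suc j , n)) (F.sym (F.zeroˡ _))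

  dot-insertAt : ∀ {d} (a : Vec d) p c (w : Vec (suc d)) → dot (Vector.insertAt a p c) w ≈ c ⊗ w p ⊕ dot a (w ∘ punchIn p)
  dot-insertAt         a zero    c w = F.refl
  dot-insertAt {suc d} a (suc p) c w = F.trans (F.+-congˡ (dot-insertAt (tail a) p c (tail w)))
    (solve 3 (λ x y z → x :+ (y :+ z) := y :+ (x :+ z)) F.refl _ _ _)

  -- One step of Gaussian elimination: subtracting multiples of `b p` from the other vectors makes
  -- `φ` vanish on them, and a relation among the results expands to one among the `b j`.
  eliminate-form : ∀ {m d} (φ : Vec m) (b : Fin (suc d) → Vec m) → Independent b →
    ∃ λ p → ∃ λ (c : Vec d) → let b′ = λ j i → b (punchIn p j) i ⊕ c j ⊗ b p i in
      Independent b′ × (∀ j → dot φ (b′ j) ≈ 0#)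
  eliminate-form φ b ind with pivot (λ j → dot φ (b j))
  ... | p , γ , β≈ = p , (λ j → ⊖ γ j) , independent , vanish
    where
    vanish : ∀ j → dot φ (λ i → b (punchIn p j) i ⊕ ⊖ γ j ⊗ b p i) ≈ 0#
    vanish j = F.trans (dot-linear φ (b (punchIn p j)) (b p) (⊖ γ j)) (F.trans (F.+-congʳ (β≈ j)) (⊖-⊗ (γ j) _))
    dot-shift : ∀ {d} (a x c : Vec d) k → dot a (λ j → x j ⊕ c j ⊗ k) ≈ dot a c ⊗ k ⊕ dot a x
    dot-shift a x c k = F.trans (dot-cong (λ _ → F.refl) (λ j → F.+-congˡ (F.*-comm (c j) k)))
      (F.trans (dot-linear a x c k) (F.trans (F.+-comm _ _) (F.+-congʳ (F.*-comm k _))))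
    independent : Independent (λ j i → b (punchIn p j) i ⊕ ⊖ γ j ⊗ b p i)
    independent a e j = F.trans (F.reflexive (sym (Vector.insertAt-punchIn a p _ j)))
      (ind (Vector.insertAt a p (dot a (λ j → ⊖ γ j)))
        (λ i → F.trans (dot-insertAt a p _ (λ j → b j i))
               (F.trans (F.sym (dot-shift a (λ j → b (punchIn p j) i) (λ j → ⊖ γ j) (b p i))) (e i)))
        (punchIn p j))

  -- The forms are eliminated one at a time. `V` carries what is already secured, in particular the
  -- vanishing of earlier forms; closure under x + c y preserves it in later eliminations.
  common-kernel : ∀ {m} r {d} (φ : Fin r → Vec m) (V : Vec m → Set) → (∀ {x y} c → V x → V y → V (λ i → x i ⊕ c ⊗ y i)) →
    (b : Fin (r + d) → Vec m) → Independent b → (∀ j → V (b j)) →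
    ∃ λ (b′ : Fin d → Vec m) → Independent b′ × (∀ j → V (b′ j)) × (∀ i j → dot (φ i) (b′ j) ≈ 0#)
  common-kernel zero    φ V closed b ind b∈V = b , ind , b∈V , λ ()
  common-kernel (suc r) φ V closed b ind b∈V with eliminate-form (φ zero) b ind
  ... | p , c , ind₁ , vanish₁ with common-kernel r (φ ∘ suc) (λ x → V x × dot (φ zero) x ≈ 0#)
      (λ {x} {y} k (x∈ , φx≈0) (y∈ , φy≈0) → closed k x∈ y∈ ,
        F.trans (dot-linear (φ zero) x y k) (F.trans (F.+-cong φx≈0 (F.trans (F.*-congˡ φy≈0) (F.zeroʳ k))) (F.+-identityˡ 0#)))
      _ ind₁ (λ j → closed (c j) (b∈V (punchIn p j)) (b∈V p) , vanish₁ j)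
  ...   | b′ , ind′ , inside , vanish = b′ , ind′ , proj₁ ∘ inside , λ { zero j → proj₂ (inside j) ; (suc i) j → vanish i j }

  kernel-basis : ∀ r d {m} → m ≡ r + d → (φ : Fin r → Vec m) →
    ∃ λ (b : Fin d → Vec m) → Independent b × (∀ i j → dot (φ i) (b j) ≈ 0#)
  kernel-basis r d refl φ with common-kernel r φ (λ _ → ⊤) (λ _ _ _ → tt) unit unit-independent (λ _ → tt)
  ... | b , ind , _ , vanish = b , ind , vanish

  matrices : ∀ d m → List (Fin d → Vec m)
  matrices d m = tuples (vectors m) d

  length-matrices : ∀ d m → length (matrices d m) ≡ (q ^ m) ^ d
  length-matrices d m = trans (length-tuples (vectors m) d) (cong (_^ d) (length-vectors m))

  Solves : ∀ {d m} → (Fin d → Vec m) → Vec m → Vec d → Set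
  Solves A x s = ∀ i → dot (A i) x ≈ s i

  Solves? : ∀ {d m} (A : Fin d → Vec m) x s → Dec (Solves A x s)
  Solves? A x s = Fin.all? λ i → dot (A i) x ≈? s i

  -- Each of the d rows has to lie on an affine hyperplane, which contains q^m vectors, and the rows
  -- are chosen independently.
  count-Solves : ∀ d {m} .{{_ : NonZero q}} (x : Vec (suc m)) s → ¬ Zero x →
    ∑[ A ← matrices d (suc m) ] 𝟙 (Solves? A x s) ≡ (q ^ m) ^ d
  count-Solves d {m} x s x≉0 =
    trans (∑-cong (matrices d (suc m)) λ A → 𝟙-all (λ i → dot (A i) x ≈? s i) _)
    (trans (∑-tuples-∏ (vectors (suc m)) d (λ i r → 𝟙 (dot r x ≈? s i)))
    (trans (∏-cong λ i → *-cancelˡ-≡ _ (q ^ m) q (count-hyperplane x (s i) x≉0)) (∏-const d _)))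

  count-Solves₂ : ∀ d {m} .{{_ : NonZero q}} (x y : Vec (suc (suc m))) s t → Indep x y →
    ∑[ A ← matrices d (suc (suc m)) ] (𝟙 (Solves? A x s) * 𝟙 (Solves? A y t)) ≡ (q ^ m) ^ d
  count-Solves₂ d {m} x y s t ind =
    trans (∑-cong (matrices d (suc (suc m))) λ A →
      trans (cong₂ _*_ (𝟙-all (λ i → dot (A i) x ≈? s i) (Solves? A x s)) (𝟙-all (λ i → dot (A i) y ≈? t i) (Solves? A y t))) (sym (∏-* (λ i → 𝟙 (dot (A i) x ≈? s i)) _)))
    (trans (∑-tuples-∏ (vectors (suc (suc m))) d (λ i → count-pair x y (s i) (t i)))
    (trans (∏-cong λ i → *-cancelˡ-≡ _ (q ^ m) q (*-cancelˡ-≡ _ (q * q ^ m) q (count-codim-two x y (s i) (t i) ind))) (∏-const d _)))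

-- Projective points, pencils and the numbers θ.

AllPairs-lookup : ∀ {A : Set} {R : A → A → Set} {xs} → (∀ {x y} → R x y → R y x) → AllPairs R xs →
  ∀ {i j} → i ≢ j → R (lookup xs i) (lookup xs j)
AllPairs-lookup R-sym (x# ∷ xs#) {zero}  {zero}  i≢j = contradiction refl i≢j
AllPairs-lookup R-sym (x# ∷ xs#) {zero}  {suc j} i≢j = All.lookup x# (∈.∈-lookup j)
AllPairs-lookup R-sym (x# ∷ xs#) {suc i} {zero}  i≢j = R-sym (All.lookup x# (∈.∈-lookup i))
AllPairs-lookup R-sym (x# ∷ xs#) {suc i} {suc j} i≢j = AllPairs-lookup R-sym xs# (i≢j ∘ cong suc)

module ProjectivePoints {q : ℕ} (𝔽 : FiniteField q) where
  open LinearAlgebra 𝔽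

  private
    module Vectors = Data.Vec.Functional.Relation.Binary.Equality.Setoid F.setoid

  vectors-distinct : ∀ m → AllPairs (λ v w → ¬ (∀ i → v i ≈ w i)) (vectors m)
  vectors-distinct zero    = [] ∷ []
  vectors-distinct (suc m) = Setoid-Unique.cartesianProductWith⁺ F.setoid (Vectors.≋-setoid m) (Vectors.≋-setoid (suc m))
    Vector._∷_ (λ e → e zero , e ∘ suc) F.enum-distinct (vectors-distinct m)

  vectors-complete : ∀ {m} (v : Vec m) → Any (λ w → ∀ i → v i ≈ w i) (vectors m)
  vectors-complete {zero}  v = here λ ()
  vectors-complete {suc m} v = Any.map (λ e → λ { zero → e zero ; (suc i) → e (suc i) })
    (Setoid-∈.∈-cartesianProductWith⁺ F.setoid (Vectors.≋-setoid m) (Vectors.≋-setoid (suc m))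
      {f = Vector._∷_} (λ p r → λ { zero → p ; (suc i) → r i }) {a = head v} {b = tail v}
      (F.enum-complete (head v)) (vectors-complete (tail v)))

  -- The points of PG(m - 1, q), normalised to have leading coordinate 1.
  points : ∀ m → List (Vec m)
  points zero    = []
  points (suc m) = map (1# Vector.∷_) (vectors m) ++ map (0# Vector.∷_) (points m)

  length-points : ∀ m → length (points (suc m)) ≡ θ q m
  length-points m = trans (List.length-++ (map (1# Vector.∷_) (vectors m)))
    (trans (cong₂ _+_ (trans (List.length-map _ (vectors m)) (length-vectors m)) (List.length-map _ (points m))) (step m))
    where
    step : ∀ m → q ^ m + length (points m) ≡ θ q m
    step zero    = refl
    step (suc m) = cong (q ^ suc m +_) (length-points m)

  Multiple : ∀ {m} → Vec m → Vec m → Set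
  Multiple x p = ∃ λ c → ∀ i → x i ≈ c ⊗ p i

  points-complete : ∀ {m} (x : Vec m) → ¬ Zero x → Any (Multiple x) (points m)
  points-complete {zero}  x x≉0 = contradiction (λ ()) x≉0
  points-complete {suc m} x x≉0 with head x ≈? 0#
  ... | yes x₀≈0 = AnyP.++⁺ʳ (map (1# Vector.∷_) (vectors m)) (AnyP.map⁺ (Any.map
          (λ (c , e) → c , λ { zero → F.trans x₀≈0 (F.sym (F.zeroʳ c)) ; (suc i) → e i })
          (points-complete (tail x) λ tx≈0 → x≉0 λ { zero → x₀≈0 ; (suc i) → tx≈0 i })))
  ... | no x₀≉0 = AnyP.++⁺ˡ (AnyP.map⁺ (Any.map
          (λ e → head x , λ { zero → F.sym (F.*-identityʳ _) ; (suc i) → scaled i (e i) })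
          (vectors-complete (λ i → x (suc i) ⊗ proj₁ inverse))))
    where
    inverse = F.inverse (head x) x₀≉0
    scaled : ∀ i {w} → x (suc i) ⊗ proj₁ inverse ≈ w → x (suc i) ≈ head x ⊗ w
    scaled i e = F.trans (F.sym (cancel-inverse′ (x (suc i)) (proj₂ inverse))) (F.trans (F.*-congʳ e) (F.*-comm _ _))

  points-nonzero : ∀ m → All (λ p → ¬ Zero p) (points m)
  points-nonzero zero    = []
  points-nonzero (suc m) = AllP.++⁺ (AllP.map⁺ (All.universal (λ v z → F.0≉1 (F.sym (z zero))) (vectors m)))
    (AllP.map⁺ (All.map (λ p≉0 z → p≉0 (z ∘ suc)) (points-nonzero m)))

  -- Distinct representatives with first coordinate 1 are independent. One with first coordinate 1
  -- and one with first coordinate 0 are independent because the latter is nonzero. Induction covers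
  -- the rest.
  points-independent : ∀ m → AllPairs Indep (points m)
  points-independent zero    = []
  points-independent (suc m) = AllPairsP.++⁺
    (AllPairsP.map⁺ (AllPairs.map affine (vectors-distinct m)))
    (AllPairsP.map⁺ (AllPairs.map (λ ind α β e → ind α β (e ∘ suc)) (points-independent m)))
    (AllP.map⁺ (All.universal (λ v → AllP.map⁺ (All.map (mixed v) (points-nonzero m))) (vectors m)))
    where
    affine : ∀ {v w : Vec m} → ¬ (∀ i → v i ≈ w i) → Indep (1# Vector.∷ v) (1# Vector.∷ w)
    affine {v} {w} v≉w α β e with α ≈? 0#
    ... | yes α≈0 = α≈0 , F.trans (F.sym (F.trans (F.+-cong (F.*-identityʳ α) (F.*-identityʳ β)) (F.trans (F.+-congʳ α≈0) (F.+-identityˡ β)))) (e zero)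
    ... | no α≉0 = contradiction (λ i → ⊗-cancelʳ (v i) (w i) α≉0 (F.trans (F.*-comm _ α) (F.trans (agree i) (F.*-comm α _)))) v≉w
      where
      α+β : α ⊕ β ≈ 0#
      α+β = F.trans (F.sym (F.+-cong (F.*-identityʳ α) (F.*-identityʳ β))) (e zero)
      agree : ∀ i → α ⊗ v i ≈ α ⊗ w i
      agree i = +-cancelʳ (β ⊗ w i) (F.trans (e (suc i))
        (F.sym (F.trans (F.sym (F.distribʳ (w i) α β)) (F.trans (F.*-congʳ α+β) (F.zeroˡ (w i))))))
    mixed : ∀ v {p : Vec m} → ¬ Zero p → Indep (1# Vector.∷ v) (0# Vector.∷ p)
    mixed v {p} p≉0 α β e = α≈0 , decidable-stable (β ≈? 0#) λ β≉0 → p≉0 λ i →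
      ⊗-zero (p i) β≉0 (F.trans (F.*-comm _ β) (F.trans (F.sym (drop i)) (e (suc i))))
      where
      α≈0 : α ≈ 0#
      α≈0 = F.trans (F.sym (F.trans (F.+-cong (F.*-identityʳ α) (F.zeroʳ β)) (F.+-identityʳ α))) (e zero)
      drop : ∀ i → α ⊗ v i ⊕ β ⊗ p i ≈ β ⊗ p i
      drop i = F.trans (F.+-congʳ (F.trans (F.*-congʳ α≈0) (F.zeroˡ (v i)))) (F.+-identityˡ _)

  Index : ℕ → Set
  Index m = Fin (length (points m))

  point : ∀ {m} → Index m → Vec m
  point {m} = lookup (points m)

  point-nonzero : ∀ {m} (i : Index m) → ¬ Zero (point i)
  point-nonzero {m} i = All.lookup (points-nonzero m) (∈.∈-lookup i)

  point-independent : ∀ {m} {i j : Index m} → i ≢ j → Indep (point i) (point j)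
  point-independent {m} = AllPairs-lookup (λ {x} {y} → Indep-sym {x = x} {y}) (points-independent m)

  -- Replaces a point by the index of its normalised representative, which makes equality of points
  -- decidable and reduces colourings to functions on a finite type.
  module Code {m : ℕ} (x : Vec m) (x≉0 : ¬ Zero x) where
    code : Index m
    code = Any.index (points-complete x x≉0)

    code-multiple : Multiple x (point code)
    code-multiple = AnyP.lookup-index (points-complete x x≉0)

    code-unique : ∀ {j} → Multiple x (point j) → code ≡ j
    code-unique {j} (d , x≈dp) with code Fin.≟ j
    ... | yes e = e
    ... | no i≢j = let c , x≈cp = code-multiple in contradiction
      (λ i → F.trans (x≈cp i) (F.trans (F.*-congʳ (proj₁ (point-independent i≢j c (⊖ d) λ i →
        F.trans (F.+-congʳ (F.trans (F.sym (x≈cp i)) (x≈dp i))) (⊖-⊗ d _)))) (F.zeroˡ _))) x≉0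

  multiple-sym : ∀ {m} {x p : Vec m} → ¬ Zero x → Multiple x p → Multiple p x
  multiple-sym {x = x} {p} x≉0 (c , x≈cp) = proj₁ inverse ,
    λ i → F.trans (F.sym (cancel-inverse (p i) (proj₂ inverse))) (F.trans (F.*-comm _ _) (F.*-congˡ (F.trans (F.*-comm _ c) (F.sym (x≈cp i)))))
    where
    inverse = F.inverse c λ c≈0 → x≉0 λ i → F.trans (x≈cp i) (F.trans (F.*-congʳ c≈0) (F.zeroˡ _))

  -- The preimage under A of the point ⟨u⟩, together with the kernel of A.
  InPencil : ∀ {d m} → (Fin d → Vec m) → Vec d → Vec m → Set
  InPencil A u x = ∃ λ s → Solves A x (λ i → s ⊗ u i)

  InPencil-multiple : ∀ {d m} (A : Fin d → Vec m) u {x y} → InPencil A u x → Multiple y x → InPencil A u y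
  InPencil-multiple A u {x} (s , e) (c , y≈cx) = c ⊗ s , λ i →
    F.trans (dot-cong (λ _ → F.refl) y≈cx) (F.trans (dot-scale (A i) x c) (F.trans (F.*-congˡ (e i)) (F.sym (F.*-assoc c s (u i)))))

  Solves-cong : ∀ {d m} (A : Fin d → Vec m) {x s t} → (∀ i → s i ≈ t i) → Solves A x s → Solves A x t
  Solves-cong A e p i = F.trans (p i) (e i)

  InPencil? : ∀ {d m} (A : Fin d → Vec m) u x → Dec (InPencil A u x)
  InPencil? A u x = map′ Any.satisfied
    (λ (s , p) → Any.map (λ {a} s≈a → Solves-cong A {x} (λ i → F.*-congʳ s≈a) p) (F.enum-complete s))
    (Any.any? (λ s → Solves? A x λ i → s ⊗ u i) elements)

  -- As u is nonzero, the scalar s with A x = s u is unique, so the indicator splits into those of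
  -- events that `count-Solves` counts.
  𝟙-InPencil : ∀ {d m} (A : Fin d → Vec m) {u} x → ¬ Zero u →
    𝟙 (InPencil? A u x) ≡ ∑[ s ← elements ] 𝟙 (Solves? A x (λ i → s ⊗ u i))
  𝟙-InPencil A {u} x u≉0 with InPencil? A u x
  ... | no ∉ = sym (∑𝟙-none (λ s → Solves? A x (λ i → s ⊗ u i)) (All.universal (λ s p → ∉ (s , p)) elements))
  ... | yes (s , p) = sym (∑𝟙-unique (λ s → Solves? A x (λ i → s ⊗ u i))
    (AllPairs.map (λ {a} {b} a≉b p r → u≉0 λ i → decidable-stable (u i ≈? 0#) λ ui≉0 →
      a≉b (⊗-cancelʳ a b ui≉0 (F.trans (F.sym (p i)) (r i)))) F.enum-distinct)
    (Any.map (λ {a} s≈a → Solves-cong A {x} (λ i → F.*-congʳ s≈a) p) (F.enum-complete s)))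

  -- If A x = s u = t v with u and v independent, then s = 0.
  pencil-disjoint : ∀ {d m} (A : Fin d → Vec m) {u v} x → Indep u v → InPencil A u x → InPencil A v x → Solves A x (const 0#)
  pencil-disjoint A {u} {v} x ind (s , p) (t , r) i = F.trans (p i) (F.trans (F.*-congʳ s≈0) (F.zeroˡ (u i)))
    where
    s≈0 : s ≈ 0#
    s≈0 = proj₁ (ind s (⊖ t) λ i → F.trans (F.+-congʳ (F.trans (F.sym (p i)) (r i))) (⊖-⊗ t (v i)))

-- In the induction step, 12θ_k ≤ 13q^k ≤ q^(k+1) absorbs all lower powers into one extra copy of
-- the leading one.
θ-≤ : ∀ q k → 13 ≤ q → 12 * θ q k ≤ 13 * q ^ k
θ-≤ q zero    13≤q = m≤m+n 12 1
θ-≤ q (suc k) 13≤q = begin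
  12 * (q ^ suc k + θ q k) ≡⟨ *-distribˡ-+ 12 (q ^ suc k) (θ q k) ⟩
  12 * q ^ suc k + 12 * θ q k ≤⟨ +-monoʳ-≤ (12 * q ^ suc k) (≤-trans (θ-≤ q k 13≤q) (*-monoˡ-≤ (q ^ k) 13≤q)) ⟩
  12 * q ^ suc k + q ^ suc k ≡⟨ +-comm (12 * q ^ suc k) (q ^ suc k) ⟩
  13 * q ^ suc k ∎
  where open ≤-Reasoning

θ-mono : ∀ q {k n} → k ≤ n → θ q k ≤ θ q n
θ-mono q {n = zero}  z≤n = ≤-refl
θ-mono q {n = suc n} k≤n with m≤n⇒m<n∨m≡n k≤n
... | inj₁ k<n  = m≤n⇒m≤o+n (q ^ suc n) (θ-mono q (s≤s⁻¹ k<n))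
... | inj₂ refl = ≤-refl

2θ≤θ : ∀ q {k n} → 13 ≤ q → k < n → 2 * θ q k ≤ θ q n
2θ≤θ q {k} {n} 13≤q k<n = begin
  2 * θ q k ≡⟨ cong (θ q k +_) (+-identityʳ (θ q k)) ⟩
  θ q k + θ q k ≤⟨ +-monoˡ-≤ (θ q k) (≤-trans (m≤n*m (θ q k) 12) (≤-trans (θ-≤ q k 13≤q) (*-monoˡ-≤ (q ^ k) 13≤q))) ⟩
  θ q (suc k) ≤⟨ θ-mono q k<n ⟩
  θ q n ∎
  where open ≤-Reasoning

^-distribʳ-* : ∀ a b n → (a * b) ^ n ≡ a ^ n * b ^ n
^-distribʳ-* a b zero    = refl
^-distribʳ-* a b (suc n) = trans (cong (a * b *_) (^-distribʳ-* a b n)) (e a b (a ^ n) (b ^ n))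
  where
  e : ∀ a b c d → a * b * (c * d) ≡ a * c * (b * d)
  e = solve-∀

-- Pencils as projective subspaces, and the upper bound on the number of colours.

module PencilSpaces {q : ℕ} (𝔽 : FiniteField q) (n : ℕ) where
  open LinearAlgebra 𝔽
  open ProjectivePoints 𝔽
  open Projective 𝔽 n hiding (ℋ)

  lincomb-dot : ∀ {d} (a : Vec d) (b : Fin d → Vect) i → lincomb a b i ≡ dot a (λ j → b j i)
  lincomb-dot {zero}  a b i = refl
  lincomb-dot {suc d} a b i = cong (a zero ⊗ b zero i ⊕_) (lincomb-dot (tail a) (tail b) i)

  pt : Index (suc n) → Point
  pt i = record { vec = point i ; nonzero = point-nonzero i }

  module _ (x : Point) where
    open Code (Point.vec x) (Point.nonzero x) public

  ≈P⇒code≡ : ∀ {x y} → x ≈P y → code x ≡ code y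
  ≈P⇒code≡ {x} {y} (l , y≈lx) = let c , x≈cp = code-multiple x in
    sym (code-unique y (l ⊗ c , λ i → F.trans (y≈lx i) (F.trans (F.*-congˡ (x≈cp i)) (F.sym (F.*-assoc l c _)))))

  code≡⇒≈P : ∀ {x y} → code x ≡ code y → x ≈P y
  code≡⇒≈P {x} {y} e with code y | e | code-multiple y
  ... | _ | refl | c , y≈cp = let d , p≈dx = multiple-sym (Point.nonzero x) (code-multiple x) in
    c ⊗ d , λ i → F.trans (y≈cp i) (F.trans (F.*-congˡ (p≈dx i)) (F.sym (F.*-assoc c d _)))

  code-pt : ∀ i → code (pt i) ≡ i
  code-pt i = code-unique (pt i) (1# , λ j → F.sym (F.*-identityˡ _))

  pt-code : ∀ x → pt (code x) ≈P x
  pt-code x = code-multiple x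

  ∈S-multiple : ∀ {m} {U : Subspace m} {x y} → x ≈P y → x ∈S U → y ∈S U
  ∈S-multiple {U = U} {x} {y} (c , y≈cx) (a , x≈) = (λ j → c ⊗ a j) , λ i → F.trans (y≈cx i)
    (F.trans (F.*-congˡ (F.trans (x≈ i) (F.reflexive (lincomb-dot a b i))))
    (F.trans (F.sym (F.trans (dot-comm (λ j → c ⊗ a j) (λ j → b j i)) (F.trans (dot-scale (λ j → b j i) a c) (F.*-congˡ (dot-comm (λ j → b j i) a)))))
             (F.reflexive (sym (lincomb-dot (λ j → c ⊗ a j) b i)))))
    where b = Subspace.basis U

  -- x lies in A⁻¹⟨u⟩ iff (t , x) is in the kernel of [ u | A ] for some t.
  pencil-subspace : ∀ {d m} → suc (suc n) ≡ d + suc m → (A : Fin d → Vec (suc n)) (u : Vec d) → ¬ Zero u →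
    Σ (Subspace m) λ H → ∀ x → x ∈S H → InPencil A u (Point.vec x)
  pencil-subspace {d} {m} dims A u u≉0 with kernel-basis d (suc m) dims (λ i → u i Vector.∷ A i)
  ... | b , ind , vanish = record { basis = tail ∘ b ; independent = independent } , inside
    where
    combination : Vec (suc m) → Vec (suc (suc n))
    combination a i = dot a (λ j → b j i)
    kernel : ∀ a i → u i ⊗ combination a zero ⊕ dot (A i) (tail (combination a)) ≈ 0#
    kernel a i = F.trans (dot-dot (u i Vector.∷ A i) a b) (dot-zeroʳ a (vanish i))
    independent : ∀ a → (∀ i → lincomb a (tail ∘ b) i ≈ 0#) → ∀ j → a j ≈ 0#
    -- Forgetting the coordinate t is injective on the kernel: if all other coordinates vanish, then
    -- t u = 0 with u nonzero.
    independent a e = ind a λ { zero → decidable-stable (combination a zero ≈? 0#) (λ t≉0 → u≉0 λ i → ⊗-zero (u i) t≉0 (u⊗t i)) ; (suc i) → tail≈0 i }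
      where
      tail≈0 : Zero (tail (combination a))
      tail≈0 i = F.trans (F.reflexive (sym (lincomb-dot a (tail ∘ b) i))) (e i)
      u⊗t : ∀ i → u i ⊗ combination a zero ≈ 0#
      u⊗t i = F.trans (F.sym (F.trans (F.+-congˡ (dot-zeroʳ (A i) tail≈0)) (F.+-identityʳ _))) (kernel a i)
    inside : ∀ x → _ → InPencil A u (Point.vec x)
    inside x (a , x≈) = ⊖ t , λ i → +-cancelʳ (t ⊗ u i) (begin
      dot (A i) (Point.vec x) ⊕ t ⊗ u i
        ≈⟨ F.+-congʳ (dot-cong {a = A i} (λ _ → F.refl) (λ i → F.trans (x≈ i) (F.reflexive (lincomb-dot a (tail ∘ b) i)))) ⟩
      dot (A i) (tail (combination a)) ⊕ t ⊗ u i ≈⟨ F.+-comm _ _ ⟩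
      t ⊗ u i ⊕ dot (A i) (tail (combination a)) ≈⟨ F.+-congʳ (F.*-comm t (u i)) ⟩
      u i ⊗ t ⊕ dot (A i) (tail (combination a)) ≈⟨ kernel a i ⟩
      0# ≈⟨ ⊖-⊗ t (u i) ⟨
      t ⊗ u i ⊕ ⊖ t ⊗ u i ≈⟨ F.+-comm _ _ ⟩
      ⊖ t ⊗ u i ⊕ t ⊗ u i ∎)
      where
      open ≈-Reasoning F.setoid
      t : Carrier
      t = combination a zero

-- The projective dimension is n + 1 here, so vectors have n + 2 coordinates and prescribing values
-- at two independent vectors leaves q^n choices per row.
module ChromaticBound {q : ℕ} (𝔽 : FiniteField q) (n k : ℕ) (13≤q : 13 ≤ q) (k<n : k < suc n) where
  open LinearAlgebra 𝔽
  open ProjectivePoints 𝔽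
  open PencilSpaces 𝔽 (suc n)
  open Projective 𝔽 (suc n)

  private
    instance
      q≢0 : NonZero q
      q≢0 = >-nonZero (≤-trans (s≤s z≤n) 13≤q)
      q^≢0 : NonZero (q ^ n)
      q^≢0 = m^n≢0 q n

    d : ℕ
    d = suc k
    Ms : List (Fin d → Vec (suc (suc n)))
    Ms = matrices d (suc (suc n))
    us : List (Index d)
    us = allFin _
    -- `y` counts the matrices with prescribed values at two independent vectors; allowing any
    -- multiples of u as values gives q²y = `Y`. Since q^d = qK, one point gives KY matrices, and
    -- there are K²Y matrices in all.
    K y Y : ℕ
    K = q ^ k
    y = (q ^ n) ^ d
    Y = q * (q * y)

    length-us : length us ≡ θ q k
    length-us = trans (List.length-tabulate id) (length-points k)

    scaled : ∀ x u → ¬ Zero x → ∑[ A ← Ms ] 𝟙 (InPencil? A (point u) x) ≡ q * (q ^ suc n) ^ d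
    scaled x u x≉0 = trans (∑-cong Ms λ A → 𝟙-InPencil A x (point-nonzero u)) (trans (∑-comm Ms elements _)
      (trans (∑-cong elements λ s → count-Solves d x (λ i → s ⊗ point u i) x≉0) (∑-elements-const _)))

    ^-suc-suc : (q ^ suc n) ^ d ≡ q * K * y
    ^-suc-suc = ^-distribʳ-* q (q ^ n) d

    K*Y : q * (q ^ suc n) ^ d ≡ K * Y
    K*Y = trans (cong (q *_) ^-suc-suc) (e q K y)
      where
      e : ∀ q K y → q * (q * K * y) ≡ K * (q * (q * y))
      e = solve-∀

    total : length Ms ≡ K * K * Y
    total = trans (length-matrices d (suc (suc n))) (trans (^-distribʳ-* q (q ^ suc n) d)
      (trans (cong (q * K *_) ^-suc-suc) (e q K y)))
      where
      e : ∀ q K y → q * K * (q * K * y) ≡ K * K * (q * (q * y))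
      e = solve-∀

    second : ∀ u {i j : Index (suc (suc n))} → i ≢ j →
      ∑[ A ← Ms ] (𝟙 (InPencil? A (point u) (point i)) * 𝟙 (InPencil? A (point u) (point j))) ≡ Y
    second u {i} {j} i≢j = trans
      (∑-cong Ms λ A → trans (cong₂ _*_ (𝟙-InPencil A (point i) (point-nonzero u)) (𝟙-InPencil A (point j) (point-nonzero u)))
                             (∑-*-∑ elements elements _ _))
      (trans (∑-comm Ms elements _) (trans (∑-cong elements λ s → trans (∑-comm Ms elements _)
        (trans (∑-cong elements λ t → count-Solves₂ d (point i) (point j) (λ l → s ⊗ point u l) (λ l → t ⊗ point u l) (point-independent i≢j))
               (∑-elements-const y))) (∑-elements-const (q * y))))

    disjoint : ∀ (A : Fin d → Vec (suc (suc n))) (x : Index (suc (suc n))) → ¬ Solves A (point x) (const 0#) → ∑[ u ← us ] 𝟙 (InPencil? A (point u) (point x)) ≤ 1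
    disjoint A x ∉ = ∑𝟙-≤1 (λ u → InPencil? A (point u) (point x))
      (AllPairs.map (λ u≢v p r → ∉ (pencil-disjoint A (point x) (point-independent u≢v) p r)) (Unique.allFin⁺ _))

    u₀ : Index d
    u₀ = Code.code {d} (const 1#) (λ e → F.0≉1 (F.sym (e zero)))

    0<Y : 0 < Y
    0<Y = *-mono-≤ 0<q (*-mono-≤ 0<q (m^n>0 (q ^ n) d))
      where
      0<q : 0 < q
      0<q = ≤-trans (s≤s z≤n) 13≤q

    Inside : (Fin d → Vec (suc (suc n))) → Index d → Index (suc (suc n)) → Set
    Inside A u x = InPencil A (point u) (point x)

    Inside? : ∀ A (u : Index d) (x : Index (suc (suc n))) → Dec (Inside A u x)
    Inside? A u x = InPencil? {d} {suc (suc n)} A (point u) (point x)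

    Base : (Fin d → Vec (suc (suc n))) → Index (suc (suc n)) → Set
    Base A x = Solves A (point x) (const 0#)

    module Colouring = PencilColouring Ms us u₀ (length (points (suc (suc n))))
      Inside Inside? Base (λ A x → Solves? {d} {suc (suc n)} A (point x) (const 0#))
      q K Y (m^n>0 q k) 0<Y 13≤q
      (subst (λ t → 12 * t ≤ 13 * K) (sym length-us) (θ-≤ q k 13≤q))
      (subst₂ (λ t P → 2 * t ≤ P) (sym length-us) (sym (length-points (suc n))) (2θ≤θ q 13≤q k<n))
      (λ u x → trans (scaled (point x) u (point-nonzero x)) K*Y)
      second
      (λ x → trans (cong (q *_) (count-Solves d (point x) (const 0#) (point-nonzero x))) K*Y)
      total disjoint

  dims : suc (suc (suc n)) ≡ d + suc (suc n ∸ k)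
  dims = cong suc (trans (cong suc (sym (m+[n∸m]≡n (<⇒≤ k<n)))) (sym (+-suc k (suc n ∸ k))))

  upper-bound : ∀ N → HasNonRainbowColouring (ℋ (suc n ∸ k)) N → N + 2 * θ q k ≤ suc (θ q (suc n))
  upper-bound N (colouring , nonrainbow) =
    subst₂ (λ t P → N + 2 * t ≤ suc P) length-us (length-points (suc n)) (Colouring.colour-bound (colour ∘ pt) onto repeated)
    where
    open StrictColouring colouring
    onto : ∀ j → ∃ λ i → colour (pt i) ≡ j
    onto j = let v , e = surjective j in code v , trans (respects (pt-code v)) e
    Repeated : _ → _ → _ → _ → Set
    Repeated A u i j = i ≢ j × InPencil A (point u) (point i) × InPencil A (point u) (point j) × colour (pt i) ≡ colour (pt j)
    repeated : ∀ A u → ∃ λ i → ∃ λ j → Repeated A u i j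
    repeated A u with Fin.any? (λ i → Fin.any? λ j → ¬? (i Fin.≟ j) ×-dec InPencil? A (point u) (point i)
                               ×-dec InPencil? A (point u) (point j) ×-dec colour (pt i) Fin.≟ colour (pt j))
    ... | yes found = found
    -- Without a repeated colour in A⁻¹⟨u⟩, the subspace contained in it would be a rainbow
    -- hyperedge.
    ... | no none with pencil-subspace dims A (point u) (point-nonzero u)
    ...   | H , inside = contradiction rainbow (nonrainbow H)
      where
      in-pencil : ∀ v → v ∈S H → InPencil A (point u) (point (code v))
      in-pencil v v∈ = InPencil-multiple A (point u) (inside v v∈) (multiple-sym {p = point (code v)} (Point.nonzero v) (code-multiple v))
      rainbow : Rainbow (ℋ (suc n ∸ k)) colouring H
      rainbow v w v∈ w∈ same = code≡⇒≈P {v} {w} (decidable-stable (code v Fin.≟ code w) λ v≢w → none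
        (code v , code w , v≢w , in-pencil v v∈ , in-pencil w w∈ ,
         trans (respects (pt-code v)) (trans same (sym (respects (pt-code w))))))

-- Colourings from 2-transversals, and sets meeting every hyperedge.

length-filter : ∀ {A : Set} {P : A → Set} (P? : Unary.Decidable P) xs → length (filter P? xs) ≡ ∑[ x ← xs ] 𝟙 (P? x)
length-filter P? []       = refl
length-filter P? (x ∷ xs) with P? x
... | yes _ = cong suc (length-filter P? xs)
... | no _  = length-filter P? xs

Unique-index : ∀ {A : Set} {xs : List A} → AllPairs _≢_ xs → ∀ i (p : lookup xs i ∈ xs) → Any.index p ≡ i
Unique-index xs! i p with Any.index p Fin.≟ i
... | yes e = e
... | no e≢ = contradiction (AnyP.lookup-index p) (AllPairs-lookup (_∘ sym) xs! (e≢ ∘ sym))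

-- Only an inequality, as `L` may repeat entries: every index in `L` is charged to an entry, and
-- each entry is charged by a single index.
complement-length : ∀ {n} (L : List (Fin n)) → n ≤ length (filter (λ i → ¬? (Any.any? (i Fin.≟_) L)) (allFin n)) + length L
complement-length {n} L = begin
  n ≡⟨ ∑-allFin-1 n ⟨
  ∑ (allFin n) (const 1) ≡⟨ ∑-cong (allFin n) (λ i → 𝟙-¬ (in? i)) ⟨
  ∑[ i ← allFin n ] (𝟙 (in? i) + 𝟙 (¬? (in? i))) ≡⟨ ∑-+ (allFin n) _ _ ⟩
  (∑[ i ← allFin n ] 𝟙 (in? i)) + (∑[ i ← allFin n ] 𝟙 (¬? (in? i)))
    ≤⟨ +-monoˡ-≤ _ (∑-mono (allFin n) hit) ⟩
  (∑[ i ← allFin n ] ∑[ j ← L ] 𝟙 (i Fin.≟ j)) + (∑[ i ← allFin n ] 𝟙 (¬? (in? i)))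
    ≡⟨ cong₂ _+_ (trans (∑-comm (allFin n) L _) (trans (∑-cong L once) (length-∑ L))) (sym (length-filter (¬? ∘ in?) (allFin n))) ⟩
  length L + length (filter (¬? ∘ in?) (allFin n)) ≡⟨ +-comm (length L) _ ⟩
  length (filter (¬? ∘ in?) (allFin n)) + length L ∎
  where
  open ≤-Reasoning
  in? : ∀ i → Dec (i ∈ L)
  in? i = Any.any? (i Fin.≟_) L
  hit : ∀ i → 𝟙 (in? i) ≤ ∑[ j ← L ] 𝟙 (i Fin.≟ j)
  hit i with in? i
  ... | yes i∈ = ∑𝟙-≥1 (i Fin.≟_) i∈
  ... | no _   = z≤n
  once : ∀ j → ∑[ i ← allFin n ] 𝟙 (i Fin.≟ j) ≡ 1
  once j = trans (∑-cong (allFin n) λ i → sym (*-identityʳ _)) (∑-δ j (const 1))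

module Transversals {q : ℕ} (𝔽 : FiniteField q) (n m : ℕ) where
  open LinearAlgebra 𝔽
  open ProjectivePoints 𝔽
  open PencilSpaces 𝔽 n
  open Projective 𝔽 n

  -- Give all points of the transversal one colour and every other point a colour of its own.
  module TransversalColouring (T : List Point) (transversal : IsTransversal (ℋ m) 2 T) (H₀ : Subspace m) where
    covered? : ∀ i → Dec (i ∈ map code T)
    covered? i = Any.any? (i Fin.≟_) (map code T)

    uncovered : List (Index (suc n))
    uncovered = filter (¬? ∘ covered?) (allFin _)

    index-colour : Index (suc n) → Fin (suc (length uncovered))
    index-colour i with covered? i
    ... | yes _ = zero
    ... | no i∉ = suc (Any.index (∈.∈-filter⁺ (¬? ∘ covered?) (∈-allFin i) i∉))

    colour-T : ∀ {x} → x ∈ T → index-colour (code x) ≡ zero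
    colour-T {x} x∈ with covered? (code x)
    ... | yes _ = refl
    ... | no x∉ = contradiction (∈.∈-map⁺ code x∈) x∉

    colour-uncovered : ∀ r → index-colour (lookup uncovered r) ≡ suc r
    colour-uncovered r with covered? (lookup uncovered r)
    ... | yes i∈ = contradiction i∈ (proj₂ (∈.∈-filter⁻ (¬? ∘ covered?) {xs = allFin _} (∈.∈-lookup r)))
    ... | no i∉  = cong suc (Unique-index (Unique.filter⁺ (¬? ∘ covered?) (Unique.allFin⁺ _)) r _)

    onto : ∀ j → ∃ λ v → index-colour (code v) ≡ j
    -- `T` meets the hyperedge `H₀`, so it is nonempty and colour zero occurs.
    onto zero with proj₂ transversal H₀
    ... | x ∷ _ , _ , _ , x∈ ∷ _ , _ = x , colour-T x∈
    onto (suc r) = pt (lookup uncovered r) , trans (cong index-colour (code-pt _)) (colour-uncovered r)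

    colouring : HasNonRainbowColouring (ℋ m) (suc (length uncovered))
    colouring = record { colour = index-colour ∘ code ; respects = λ {v} {w} → cong index-colour ∘ ≈P⇒code≡ {v} {w} ; surjective = onto } , nonrainbow
      where
      nonrainbow : ∀ H → ¬ (∀ v w → v ∈S H → w ∈S H → index-colour (code v) ≡ index-colour (code w) → v ≈P w)
      nonrainbow H rainbow with proj₂ transversal H
      ... | x ∷ y ∷ _ , _ , (x≉y ∷ _) ∷ _ , x∈T ∷ y∈T ∷ _ , x∈H ∷ y∈H ∷ _ =
        x≉y (rainbow x y x∈H y∈H (trans (colour-T x∈T) (sym (colour-T y∈T))))
      ... | _ ∷ [] , s≤s () , _

    uncovered-length : θ q n ≤ length uncovered + length T
    uncovered-length = subst₂ (λ a b → a ≤ length uncovered + b) (length-points n) (List.length-map code T) (complement-length (map code T))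

  -- The points supported on a set of d + 1 coordinates; f splits off these coordinates.
  module Block {d : ℕ} (f : Fin (suc n) → Fin (suc d) ⊎ Fin m) (g : Fin (suc d) ⊎ Fin m → Fin (suc n))
    (f∘g : ∀ s → f (g s) ≡ s) (g∘f : ∀ i → g (f i) ≡ i) where

    extend : Vec (suc d) → Vect
    extend p i = [ p , const 0# ]′ (f i)

    extend-inj₁ : ∀ p j → extend p (g (inj₁ j)) ≡ p j
    extend-inj₁ p j = cong [ p , const 0# ]′ (f∘g (inj₁ j))

    extend-nonzero : ∀ {p} → ¬ Zero p → ¬ Zero (extend p)
    extend-nonzero {p} p≉0 z = p≉0 λ j → F.trans (F.reflexive (sym (extend-inj₁ p j))) (z (g (inj₁ j)))

    block : Index (suc d) → Point
    block i = record { vec = extend (point i) ; nonzero = extend-nonzero (point-nonzero i) }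

    block-distinct : ∀ {i j} → i ≢ j → ¬ block i ≈P block j
    block-distinct {i} {j} i≢j (c , e) = F.0≉1 (F.sym (proj₁ (point-independent (i≢j ∘ sym) 1# (⊖ c) λ l →
      F.trans (F.+-congʳ (F.trans (F.*-identityˡ _) (restrict l))) (⊖-⊗ c (point i l)))))
      where
      restrict : ∀ l → point j l ≈ c ⊗ point i l
      restrict l = F.trans (F.reflexive (sym (extend-inj₁ (point j) l)))
        (F.trans (e (g (inj₁ l))) (F.*-congˡ (F.reflexive (extend-inj₁ (point i) l))))

    -- The m coordinates outside the block impose m conditions on the m + 1 coefficients.
    meets : ∀ (H : Subspace m) → ∃ λ i → block i ∈S H
    meets H with kernel-basis m 1 (+-comm 1 m) (λ j l → Subspace.basis H l (g (inj₂ j)))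
    ... | w , w-independent , vanish = code-y , ∈S-multiple {U = H} {x} {block code-y} block-multiple
          (w zero , λ i → F.reflexive (sym (lincomb-dot (w zero) b i)))
      where
      b = Subspace.basis H
      w≉0 : ¬ Zero (w zero)
      w≉0 w≈0 = F.0≉1 (F.sym (w-independent (const 1#)
        (λ i → F.trans (F.+-identityʳ _) (F.trans (F.*-identityˡ _) (w≈0 i))) zero))
      x-vec : Vect
      x-vec i = dot (w zero) (λ l → b l i)
      x-outside : ∀ j → x-vec (g (inj₂ j)) ≈ 0#
      x-outside j = F.trans (dot-comm (w zero) (λ l → b l (g (inj₂ j)))) (vanish j zero)
      x : Point
      x = record { vec = x-vec ; nonzero = λ z → w≉0 (Subspace.independent H (w zero)
        λ i → F.trans (F.reflexive (lincomb-dot (w zero) b i)) (z i)) }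
      y : Vec (suc d)
      y j = x-vec (g (inj₁ j))
      coordinate : ∀ {p c} → (∀ j → y j ≈ c ⊗ p j) → ∀ i → x-vec i ≈ c ⊗ extend p i
      coordinate {p} {c} e i with f i | g∘f i
      ... | inj₁ j | refl = e j
      ... | inj₂ j | refl = F.trans (x-outside j) (F.sym (F.zeroʳ c))
      y≉0 : ¬ Zero y
      y≉0 y≈0 = Point.nonzero x λ i → F.trans (coordinate {p = const 0#} {0#} (λ j → F.trans (y≈0 j) (F.sym (F.zeroˡ 0#))) i) (F.zeroˡ _)
      code-y : Index (suc d)
      code-y = Code.code y y≉0
      block-multiple : Multiple (extend (point code-y)) x-vec
      block-multiple = let c , e = Code.code-multiple y y≉0 in
        multiple-sym (Point.nonzero x) (c , coordinate e)

-- Two disjoint k-dimensional subspaces.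

module TwoBlocks {q : ℕ} (𝔽 : FiniteField q) (n k : ℕ) (k≤n : k ≤ n) (k<n∸k : k < n ∸ k) where
  open LinearAlgebra 𝔽
  open ProjectivePoints 𝔽
  open PencilSpaces 𝔽 n
  open Projective 𝔽 n
  open Transversals 𝔽 n (n ∸ k)

  private
    r : ℕ
    r = n ∸ k
    front-size : suc n ≡ suc k + r
    front-size = cong suc (sym (m+[n∸m]≡n k≤n))
    back-size : suc n ≡ r + suc k
    back-size = trans front-size (+-comm (suc k) r)

    split-front : Fin (suc n) → Fin (suc k) ⊎ Fin r
    split-front = Fin.splitAt (suc k) ∘ Fin.cast front-size

    -- The last k + 1 coordinates form the block, hence the `swap` after splitting at r.
    split-back : Fin (suc n) → Fin (suc k) ⊎ Fin r
    split-back = swap ∘ Fin.splitAt r ∘ Fin.cast back-size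

    cast-cast : ∀ {a b} (e : a ≡ b) i → Fin.cast e (Fin.cast (sym e) i) ≡ i
    cast-cast refl i = trans (Fin.cast-is-id refl _) (Fin.cast-is-id refl i)

    cast-cast′ : ∀ {a b} (e : a ≡ b) i → Fin.cast (sym e) (Fin.cast e i) ≡ i
    cast-cast′ refl i = trans (Fin.cast-is-id refl _) (Fin.cast-is-id refl i)

  module Front = Block split-front (Fin.cast (sym front-size) ∘ Fin.join (suc k) r)
    (λ s → trans (cong (Fin.splitAt (suc k)) (cast-cast front-size (Fin.join (suc k) r s))) (Fin.splitAt-join (suc k) r s))
    (λ i → trans (cong (Fin.cast (sym front-size)) (Fin.join-splitAt (suc k) r (Fin.cast front-size i))) (cast-cast′ front-size i))

  module Back = Block split-back (Fin.cast (sym back-size) ∘ Fin.join r (suc k) ∘ swap)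
    (λ s → trans (cong (swap ∘ Fin.splitAt r) (cast-cast back-size (Fin.join r (suc k) (swap s))))
      (trans (cong swap (Fin.splitAt-join r (suc k) (swap s))) (swap-involutive s)))
    (λ i → trans (cong (Fin.cast (sym back-size) ∘ Fin.join r (suc k)) (swap-involutive (Fin.splitAt r (Fin.cast back-size i))))
      (trans (cong (Fin.cast (sym back-size)) (Fin.join-splitAt r (suc k) (Fin.cast back-size i))) (cast-cast′ back-size i)))

  -- Since k + 1 ≤ r, a position below r precedes the back block and any other position lies beyond
  -- the front block.
  front-or-back : ∀ p p′ i → Front.extend p i ≡ 0# ⊎ Back.extend p′ i ≡ 0#
  front-or-back p p′ i with Fin.toℕ i <? r
  ... | yes i<r = inj₂ (cong ([ p′ , const 0# ]′ ∘ swap)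
          (Fin.splitAt-< r (Fin.cast back-size i) (subst (_< r) (sym (Fin.toℕ-cast back-size i)) i<r)))
  ... | no i≮r = inj₁ (cong [ p , const 0# ]′
          (Fin.splitAt-≥ (suc k) (Fin.cast front-size i) (subst (suc k ≤_) (sym (Fin.toℕ-cast front-size i)) (≤-trans k<n∸k (≮⇒≥ i≮r)))))

  blocks-disjoint : ∀ i j → ¬ Front.block i ≈P Back.block j
  blocks-disjoint i j (c , e) = Point.nonzero (Back.block j) zeros
    where
    zeros : ∀ l → Back.extend (point j) l ≈ 0#
    zeros l with front-or-back (point i) (point j) l
    ... | inj₁ p≡0 = F.trans (e l) (F.trans (F.*-congˡ (F.reflexive p≡0)) (F.zeroʳ c))
    ... | inj₂ p≡0 = F.reflexive p≡0

  T₀ : List Point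
  T₀ = map Front.block (allFin _) ++ map Back.block (allFin _)

  length-T₀ : length T₀ ≡ 2 * θ q k
  length-T₀ = trans (List.length-++ (map Front.block (allFin _)))
    (trans (cong₂ _+_ (half Front.block) (half Back.block)) (cong (θ q k +_) (sym (+-identityʳ _))))
    where
    half : ∀ (b : Index (suc k) → Point) → length (map b (allFin _)) ≡ θ q k
    half b = trans (List.length-map b (allFin _)) (trans (List.length-tabulate id) (length-points k))

  -- Every hyperedge meets both blocks, and disjointness makes the two points found there distinct.
  T₀-transversal : IsTransversal (ℋ (n ∸ k)) 2 T₀
  T₀-transversal = AllPairsP.++⁺ (AllPairsP.map⁺ (AllPairs.map Front.block-distinct (Unique.allFin⁺ _)))
      (AllPairsP.map⁺ (AllPairs.map Back.block-distinct (Unique.allFin⁺ _)))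
      (AllP.map⁺ (All.universal (λ i → AllP.map⁺ (All.universal (blocks-disjoint i) (allFin _))) (allFin _)))
    , λ H → let i , i∈ = Front.meets H ; j , j∈ = Back.meets H in
      Front.block i ∷ Back.block j ∷ [] , ≤-refl , (blocks-disjoint i j ∷ []) ∷ [] ∷ []
      , ∈.∈-++⁺ˡ (∈.∈-map⁺ Front.block (∈-allFin i)) ∷ ∈.∈-++⁺ʳ _ (∈.∈-map⁺ Back.block (∈-allFin j)) ∷ []
      , i∈ ∷ j∈ ∷ []

-- The upper chromatic number and τ₂.

theorem1p6 : (q n k : ℕ) → IsPrimePower q → (𝔽 : FiniteField q) →
    3 ≤ n → 1 ≤ k → 2 * k < n →
    (k ≡ 1 → 17 ≤ q) → (2 ≤ k → 13 ≤ q) →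
    let ℋ = Projective.ℋ 𝔽 n (n ∸ k) in
    UpperChromaticNumberIs ℋ (θ q n ∸ 2 * θ q k + 1)
      × TauIs ℋ 2 (2 * θ q k)
theorem1p6 q n@(suc n-1) k _ 𝔽 3≤n 1≤k 2k<n q₁ q₂ =
  (subst (HasNonRainbowColouring ℋ) colours T₀-colouring.colouring , λ M col → upper (upper-bound M col)) ,
  (T₀ , T₀-transversal , length-T₀) , minimal
  where
  open Projective 𝔽 n using (Subspace) renaming (ℋ to ℋ-of)
  ℋ : Hypergraph
  ℋ = ℋ-of (n ∸ k)
  13≤q : 13 ≤ q
  13≤q with m≤n⇒m<n∨m≡n 1≤k
  ... | inj₁ 2≤k = q₂ 2≤k
  ... | inj₂ 1≡k = ≤-trans (m≤m+n 13 4) (q₁ (sym 1≡k))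
  k+k<n : suc k + k ≤ n
  k+k<n = subst (λ z → suc (k + z) ≤ n) (+-identityʳ k) 2k<n
  k<n : k < n
  k<n = m+n≤o⇒m≤o (suc k) k+k<n
  open ChromaticBound 𝔽 n-1 k 13≤q k<n
  open TwoBlocks 𝔽 n k (<⇒≤ k<n) (m+n≤o⇒m≤o∸n (suc k) k+k<n)
  H₀ : Subspace (n ∸ k)
  -- Some hyperedge is needed to see that transversals are nonempty; the zero matrix and the
  -- all-ones vector provide one.
  H₀ = proj₁ (PencilSpaces.pencil-subspace 𝔽 n dims (λ _ _ → F.0#) (const F.1#) (λ e → F.0≉1 (F.sym (e zero))))
    where module F = FiniteField 𝔽
  module T₀-colouring = Transversals.TransversalColouring 𝔽 n (n ∸ k) T₀ T₀-transversal H₀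
  R : ℕ
  R = length T₀-colouring.uncovered
  colours : suc R ≡ θ q n ∸ 2 * θ q k + 1
  colours = trans (+-comm 1 R) (cong (_+ 1) (≤-antisym
    (m+n≤o⇒m≤o∸n R (s≤s⁻¹ (upper-bound (suc R) T₀-colouring.colouring)))
    (m≤n+o⇒m∸n≤o (θ q n) (2 * θ q k) (≤-trans T₀-colouring.uncovered-length
      (≤-reflexive (trans (cong (R +_) length-T₀) (+-comm R _)))))))
  upper : ∀ {M} → M + 2 * θ q k ≤ suc (θ q n) → M ≤ θ q n ∸ 2 * θ q k + 1
  -- 2θ_k ≤ θ_n makes the truncated subtraction exact, so the 1 can be moved out of it.
  upper {M} le = ≤-trans (m+n≤o⇒m≤o∸n M le) (≤-reflexive (trans (+-∸-assoc 1 (2θ≤θ q 13≤q k<n)) (+-comm 1 _)))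
  minimal : ∀ T → IsTransversal ℋ 2 T → 2 * θ q k ≤ length T
  -- The colouring from `T` has one colour more than there are points outside `T`, so the upper
  -- bound on colours forces at least 2θ_k points into `T`.
  minimal T transversal = +-cancelˡ-≤ (length uncovered) _ _ (≤-trans (s≤s⁻¹ (upper-bound _ colouring)) uncovered-length)
    where open Transversals.TransversalColouring 𝔽 n (n ∸ k) T transversal H₀
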